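{- Let $k,r,t$ be integers with $5\leq k\leq t-1$, $1\leq r\leq k-2$ and $t\geq 2r+2$. Write $t-2=p(k-2)+q$ with $p$ an integer and $q\in\{0,1,\ldots,k-3\}$. Then $$\operatorname{gr}_k(P_5:S_t^r)=\max\{t+p-1,\;t+1\}.$$
   Context: All graphs are finite, simple and undirected. $K_n$ is the complete graph on $n$ vertices and $P_5$ is the path with $5$ vertices and $4$ edges. $S_t^r$ is the graph of order $t$ obtained from the star $K_{1,t-1}$ by adding $r$ pairwise independent edges between the leaves, so that it has $r$ triangles (sharing the center) and $t-2r-1$ pendent edges. A $k$-edge-coloring assigns to each edge one of $k$ colors; all $k$-edge-colorings are assumed exact, i.e. each of the $k$ colors is used at least once. An edge-colored graph is rainbow if all its edges have different colors and monochromatic if all its edges have a single color. A copy of a graph means a (not necessarily induced) subgraph isomorphic to it. For non-empty graphs $G,H$ (graphs with at least one edge) and a positive integer $k$, the Gallai-Ramsey number $\operatorname{gr}_k(G:H)$ is the minimum integer $N$ with $\binom{N}{2}\geq k$ (so that $K_N$ admits a $k$-edge-coloring) such that for all $n\geq N$, every $k$-edge-coloring of $K_n$ contains either a rainbow copy of $G$ or a monochromatic copy of $H$. -}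

module Defs where

open import Data.Fin.Base using (Fin; toℕ)
import Data.Fin.Properties as Fin
open import Data.Nat.Base using (ℕ; suc; _+_; _*_; _≤_; _<_)
open import Data.Nat.Combinatorics using (_C_)
open import Data.Nat.Properties using (_≟_; _<?_; anyUpTo?; 1+n≢n)
open import Data.Product.Base using (Σ-syntax; ∃-syntax; _×_; _,_)
open import Data.Sum.Base using (_⊎_; inj₁; inj₂)
open import Function.Base using (_∘_)
open import Function.Definitions using (Injective)
open import Level using (0ℓ)
open import Relation.Binary.Construct.Closure.Symmetric
  using (SymClosure; fwd; bwd; symmetric)
open import Relation.Binary.Core using (Rel)
open import Relation.Binary.Definitions using (Symmetric; Decidable)
open import Relation.Binary.PropositionalEquality using (_≡_; _≢_; refl; sym; trans)
open import Relation.Nullary.Decidable using (map′; _×-dec_; _⊎-dec_; ¬?)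
open import Relation.Nullary.Negation using (¬_)

------------------------------------------------------------------------
-- Graphs

record Graph : Set₁ where
  field
    order      : ℕ
    Adj        : Rel (Fin order) 0ℓ
    adj-sym    : Symmetric Adj
    adj-irrefl : ∀ {u} → ¬ Adj u u
    adj?       : Decidable Adj

  V : Set
  V = Fin order

open Graph public using (V; Adj)

-- The graph on {0, …, n-1} whose edges are the pairs {u, v} with R u v.
fromRelation : (n : ℕ) (R : Rel ℕ 0ℓ) → (∀ {i} → ¬ R i i) → Decidable R → Graph
fromRelation n R R-irrefl R? = record
  { order      = n
  ; Adj        = SymClosure R′
  ; adj-sym    = symmetric R′
  ; adj-irrefl = λ { (fwd e) → R-irrefl e ; (bwd e) → R-irrefl e }
  ; adj?       = λ u v →
      map′ (λ { (inj₁ e) → fwd e ; (inj₂ e) → bwd e })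
           (λ { (fwd e) → inj₁ e ; (bwd e) → inj₂ e })
           (R? (toℕ u) (toℕ v) ⊎-dec R? (toℕ v) (toℕ u))
  }
  where
  R′ : Rel (Fin n) 0ℓ
  R′ u v = R (toℕ u) (toℕ v)

K : ℕ → Graph
K n = record
  { order      = n
  ; Adj        = _≢_
  ; adj-sym    = λ u≢v → u≢v ∘ sym
  ; adj-irrefl = λ u≢u → u≢u refl
  ; adj?       = λ u v → ¬? (u Fin.≟ v)
  }

-- The path with n vertices.
P : ℕ → Graph
P n = fromRelation n (λ i j → suc i ≡ j) 1+n≢n (λ i j → suc i ≟ j)

-- Vertex 0 is the centre of the star; the r independent edges added between
-- leaves are {1, 2}, {3, 4}, …, {2r-1, 2r}.
StarEdge : ℕ → Rel ℕ 0ℓ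
StarEdge r i j = (i ≡ 0 × 0 < j)
               ⊎ (∃[ s ] s < r × i ≡ 1 + 2 * s × j ≡ 2 + 2 * s)

starEdge-irrefl : ∀ {r i} → ¬ StarEdge r i i
starEdge-irrefl (inj₁ (refl , ()))
starEdge-irrefl (inj₂ (_ , _ , p , q)) = 1+n≢n (trans (sym q) p)

starEdge? : ∀ r → Decidable (StarEdge r)
starEdge? r i j =
  ((i ≟ 0) ×-dec (0 <? j))
  ⊎-dec anyUpTo? (λ s → (i ≟ 1 + 2 * s) ×-dec (j ≟ 2 + 2 * s)) r

-- The graph S_t^r, as  S t r.  It is only meaningful for 2r + 1 ≤ t, so that
-- the star has enough leaves for all r added edges.
S : ℕ → ℕ → Graph
S t r = fromRelation t (StarEdge r) starEdge-irrefl (starEdge? r)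

------------------------------------------------------------------------
-- Exact edge-colourings

-- An edge {u, v} has witnesses in both Adj u v and Adj v u; `well-defined`
-- forces all of them to get the same colour (also any two witnesses of Adj u v).
record ExactColouring (k : ℕ) (G : Graph) : Set where
  field
    colour       : ∀ {u v} → Adj G u v → Fin k
    well-defined : ∀ {u v} (e : Adj G u v) (e′ : Adj G v u) → colour e ≡ colour e′
    exact        : ∀ κ → ∃[ u ] ∃[ v ] Σ[ e ∈ Adj G u v ] colour e ≡ κ

open ExactColouring public using (colour)

-- A (not necessarily induced) subgraph of H isomorphic to G, given by the
-- isomorphism from G onto it.
record Copy (G H : Graph) : Set where
  field
    vertex    : V G → V H
    injective : Injective _≡_ _≡_ vertex
    edge      : ∀ {u v} → Adj G u v → Adj H (vertex u) (vertex v)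

open Copy public using (vertex; edge)

SameEnds : {A : Set} → A → A → A → A → Set
SameEnds u v x y = (u ≡ x × v ≡ y) ⊎ (u ≡ y × v ≡ x)

Rainbow : ∀ {k G H} → ExactColouring k H → Copy G H → Set
Rainbow {G = G} c f =
  ∀ {u v x y} (e : Adj G u v) (e′ : Adj G x y) →
  colour c (edge f e) ≡ colour c (edge f e′) → SameEnds u v x y

Monochromatic : ∀ {k G H} → ExactColouring k H → Copy G H → Set
Monochromatic {G = G} c f =
  ∃[ κ ] (∀ {u v} (e : Adj G u v) → colour c (edge f e) ≡ κ)

------------------------------------------------------------------------
-- Gallai-Ramsey numbers

Forces : ℕ → Graph → Graph → ℕ → Set
Forces k G H N =
  k ≤ N C 2 ×
  (∀ n → N ≤ n → (c : ExactColouring k (K n)) →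
    (Σ[ f ∈ Copy G (K n) ] Rainbow c f) ⊎ (Σ[ f ∈ Copy H (K n) ] Monochromatic c f))

-- gr_k(G : H) = N, for k ≥ 1 and graphs G, H with at least one edge.
IsGallaiRamsey : ℕ → Graph → Graph → ℕ → Set
IsGallaiRamsey k G H N = Forces k G H N × (∀ M → Forces k G H M → N ≤ M)

{-# OPTIONS --safe #-}

-- Let K_n be coloured without a rainbow P₅.  If some vertex a sees three
-- colours, then all edges avoiding a have one colour, so K_n - a contains the
-- monochromatic S_t^r.  Otherwise every vertex sees at most two colours; these
-- colour sets meet pairwise and have a union of size at least four, hence share
-- a colour ρ, and the other colours live on pairwise disjoint vertex classes.
-- By counting, some class has at least t - 1 vertices outside it.  A vertex of
-- that class is joined to all of them in colour ρ, and the remaining k - 2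
-- classes, having two vertices each, supply k - 2 ≥ r independent ρ-edges.
--
-- Conversely, K_t is avoided by giving one vertex all colours but 0 and every
-- other edge colour 0, and K_{t+p-2} by splitting the vertices into residue
-- classes modulo k - 1, each with its own colour inside, and 0 in between.

module Submission where

open import Defs
open import Data.Empty using (⊥; ⊥-elim)
open import Data.Fin.Base
  using (Fin; zero; suc; toℕ; fromℕ; fromℕ<; inject₁; inject≤; punchIn; punchOut; combine)
open import Data.Fin.Patterns
import Data.Fin.Properties as Fin
open import Data.List.Base as List
  using (List; []; _∷_; _++_; length; lookup; filter; concat; foldl; allFin)
open import Data.List.Membership.DecPropositional using () renaming (_∈?_ to member?)
open import Data.List.Membership.Propositional using (_∈_; _∉_)
import Data.List.Membership.Propositional.Properties as ∈
import Data.List.Membership.Setoid.Properties as Membership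
import Data.List.Properties as List
open import Data.List.Relation.Unary.All as All using (All; []; _∷_)
import Data.List.Relation.Unary.All.Properties as All
open import Data.List.Relation.Unary.AllPairs using ([]; _∷_)
import Data.List.Relation.Unary.AllPairs.Properties as AllPairs
open import Data.List.Relation.Unary.Any as Any using (Any; here; there)
import Data.List.Relation.Unary.Any.Properties as Any
import Data.List.Relation.Unary.Unique.Propositional as List
import Data.List.Relation.Unary.Unique.Propositional.Properties as ListUnique
open import Data.Maybe.Base using (Maybe; just; nothing)
open import Data.Nat.Base
  using (ℕ; zero; suc; _+_; _*_; _∸_; _⊔_; _⊓_; _≤_; _<_; z≤n; s≤s; z<s; s≤s⁻¹)
import Data.Nat.Combinatorics as ℕ
open import Data.Nat.DivMod using (_mod_; _%_; [m+kn]%n≡m%n; m<n⇒m%n≡m)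
import Data.Nat.Properties as ℕ
open import Data.Product.Base using (Σ-syntax; ∃-syntax; _×_; _,_; proj₁; proj₂)
open import Data.Sum.Base as Sum using (_⊎_; inj₁; inj₂)
open import Data.Vec.Base as Vec using (Vec; []; _∷_)
open import Data.Vec.Relation.Unary.All using ([]; _∷_)
open import Data.Vec.Relation.Unary.AllPairs using ([]; _∷_; allPairs?)
open import Data.Vec.Relation.Unary.Unique.Propositional using (Unique)
import Data.Vec.Relation.Unary.Unique.Propositional.Properties as Unique
open import Function.Base using (_∘_; case_of_)
open import Level using (0ℓ)
open import Relation.Binary.Construct.Closure.Symmetric using (fwd; bwd)
open import Relation.Binary.Definitions using (DecidableEquality)
open import Relation.Binary.PropositionalEquality
open import Relation.Nullary.Decidable
  using (Dec; yes; no; ¬?; _×-dec_; _⊎-dec_; decidable-stable; map′)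
open import Relation.Nullary.Negation using (¬_; contradiction)
open import Relation.Unary using (Pred; Decidable)

-- A vertex `a` with three colours is treated by the number of colours missing at `a`. Two missing
-- ones are impossible: edges carrying them avoid `a`, and whether they touch or not, a rainbow path
-- results. A single missing colour spreads from one edge to all edges off `a`. If none is missing,
-- touching edges off `a` agree in colour; a disagreement is refuted with five colours, two on these
-- edges and three at `a`. Each argument ends in a partly coloured configuration on five to seven
-- vertices, which a small verified constraint solver refutes by evaluation.
--
-- The two terms of the maximum have separate origins. From t + 1 vertices on, K_n - a still has t
-- vertices. For n = t + p - 1, if every class left at most t - 2 vertices outside, each of the k -
-- 1 classes would have at least p + 1 vertices, but (k - 1)(p + 1) exceeds n because (k - 2)(p + 1)
-- > t - 2.

unique? : ∀ {A : Set} {n} → DecidableEquality A → (xs : Vec A n) → Dec (Unique xs)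
unique? _≟_ = allPairs? (λ x y → ¬? (x ≟ y))

pathColours : {V C : Set} → (V → V → C) → Vec V 5 → Vec C 4
pathColours c (v₀ ∷ v₁ ∷ v₂ ∷ v₃ ∷ v₄ ∷ []) = c v₀ v₁ ∷ c v₁ v₂ ∷ c v₂ v₃ ∷ c v₃ v₄ ∷ []

RainbowPath : {V C : Set} → (V → V → C) → Vec V 5 → Set
RainbowPath c vs = Unique vs × Unique (pathColours c vs)

-- Colour propagation along paths

module Propagation {V C : Set} (_≟_ : DecidableEquality C)
                   {c : V → V → C} (c-sym : ∀ u v → c u v ≡ c v u)
                   (noRainbow : ∀ vs → ¬ RainbowPath c vs) where

  Edge : ℕ → Set
  Edge m = Fin m × Fin m

  -- An edge is listed with the colours still possible for it, as indices into a palette of `l`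
  -- colours. An edge without an entry may even have a colour outside the palette; a newer entry
  -- shadows older ones.
  Facts : ℕ → ℕ → Set
  Facts m l = List (Edge m × List (Fin l))

  -- A path names four edges; when three of them have known, distinct colours,
  -- the fourth must repeat one of these.  `end` draws this conclusion for the
  -- last edge of the path and `inner` for the last but one.
  data Step (m : ℕ) : Set where
    end inner : (v₀ v₁ v₂ v₃ v₄ : Fin m) → Step m

  coloured : ∀ {m l} → Fin m → Fin m → Fin l → Edge m × List (Fin l)
  coloured u v d = (u , v) , d ∷ []

  sameEdge? : ∀ {m} (e e′ : Edge m) →
              Dec (SameEnds (proj₁ e) (proj₂ e) (proj₁ e′) (proj₂ e′))
  sameEdge? (u , v) (x , y) =
    ((u Fin.≟ x) ×-dec (v Fin.≟ y)) ⊎-dec ((u Fin.≟ y) ×-dec (v Fin.≟ x))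

  domain : ∀ {m l} → Facts m l → Edge m → Maybe (List (Fin l))
  domain []              e = nothing
  domain ((e′ , D) ∷ fs) e with sameEdge? e′ e
  ... | yes _ = just D
  ... | no  _ = domain fs e

  restrict : ∀ {l} → Maybe (List (Fin l)) → List (Fin l) → List (Fin l)
  restrict nothing  xs = xs
  restrict (just D) xs = filter (λ x → member? Fin._≟_ x D) xs

  known : ∀ {m l} → Facts m l → Edge m → Maybe (Fin l)
  known fs e with domain fs e
  ... | just (x ∷ []) = just x
  ... | _             = nothing

  narrow : ∀ {m l} → Facts m l → (e₁ e₂ e₃ e : Edge m) → Facts m l
  narrow fs e₁ e₂ e₃ e with known fs e₁ | known fs e₂ | known fs e₃
  ... | nothing | _       | _       = fs
  ... | just _  | nothing | _       = fs
  ... | just _  | just _  | nothing = fs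
  ... | just x  | just y  | just z with unique? Fin._≟_ (x ∷ y ∷ z ∷ [])
  ...   | yes _ = (e , restrict (domain fs e) (x ∷ y ∷ z ∷ [])) ∷ fs
  ...   | no  _ = fs

  -- A step whose premises fail changes nothing, so every script is sound and a wrong one shows only
  -- in the final evaluation.
  infer : ∀ {m l} → Facts m l → Step m → Facts m l
  infer fs (end v₀ v₁ v₂ v₃ v₄) with unique? Fin._≟_ (v₀ ∷ v₁ ∷ v₂ ∷ v₃ ∷ v₄ ∷ [])
  ... | yes _ = narrow fs (v₀ , v₁) (v₁ , v₂) (v₂ , v₃) (v₃ , v₄)
  ... | no  _ = fs
  infer fs (inner v₀ v₁ v₂ v₃ v₄) with unique? Fin._≟_ (v₀ ∷ v₁ ∷ v₂ ∷ v₃ ∷ v₄ ∷ [])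
  ... | yes _ = narrow fs (v₀ , v₁) (v₁ , v₂) (v₃ , v₄) (v₂ , v₃)
  ... | no  _ = fs

  repeats-end : ∀ {v₀ v₁ v₂ v₃ v₄} → Unique (v₀ ∷ v₁ ∷ v₂ ∷ v₃ ∷ v₄ ∷ []) →
    Unique (c v₀ v₁ ∷ c v₁ v₂ ∷ c v₂ v₃ ∷ []) →
    Any (c v₃ v₄ ≡_) (c v₀ v₁ ∷ c v₁ v₂ ∷ c v₂ v₃ ∷ [])
  repeats-end {v₀} {v₁} {v₂} {v₃} {v₄} vs! ((p ∷ q ∷ _) ∷ (r ∷ _) ∷ _)
    with member? _≟_ (c v₃ v₄) (c v₀ v₁ ∷ c v₁ v₂ ∷ c v₂ v₃ ∷ [])
  ... | yes old = old
  ... | no  new = contradiction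
    (vs! , (p ∷ q ∷ new ∘ here ∘ sym ∷ [])
         ∷ (r ∷ new ∘ there ∘ here ∘ sym ∷ [])
         ∷ (new ∘ there ∘ there ∘ here ∘ sym ∷ []) ∷ [] ∷ [])
    (noRainbow (v₀ ∷ v₁ ∷ v₂ ∷ v₃ ∷ v₄ ∷ []))

  repeats-inner : ∀ {v₀ v₁ v₂ v₃ v₄} → Unique (v₀ ∷ v₁ ∷ v₂ ∷ v₃ ∷ v₄ ∷ []) →
    Unique (c v₀ v₁ ∷ c v₁ v₂ ∷ c v₃ v₄ ∷ []) →
    Any (c v₂ v₃ ≡_) (c v₀ v₁ ∷ c v₁ v₂ ∷ c v₃ v₄ ∷ [])
  repeats-inner {v₀} {v₁} {v₂} {v₃} {v₄} vs! ((p ∷ q ∷ _) ∷ (r ∷ _) ∷ _)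
    with member? _≟_ (c v₂ v₃) (c v₀ v₁ ∷ c v₁ v₂ ∷ c v₃ v₄ ∷ [])
  ... | yes old = old
  ... | no  new = contradiction
    (vs! , (p ∷ new ∘ here ∘ sym ∷ q ∷ [])
         ∷ (new ∘ there ∘ here ∘ sym ∷ r ∷ [])
         ∷ (new ∘ there ∘ there ∘ here ∷ []) ∷ [] ∷ [])
    (noRainbow (v₀ ∷ v₁ ∷ v₂ ∷ v₃ ∷ v₄ ∷ []))

  module Soundness {m l} (ν : Vec V m) (ν! : Unique ν) (κ : Vec C l) (κ! : Unique κ) where

    colourOf : Edge m → C
    colourOf (i , j) = c (Vec.lookup ν i) (Vec.lookup ν j)

    Within : Edge m → List (Fin l) → Set
    Within e = Any (λ d → colourOf e ≡ Vec.lookup κ d)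

    Holds : Edge m × List (Fin l) → Set
    Holds (e , D) = Within e D

    domain-sound : ∀ {fs} e {D} → All Holds fs → domain fs e ≡ just D → Within e D
    domain-sound {(e′ , _) ∷ _} e (h ∷ hs) eq with sameEdge? e′ e | eq
    ... | yes (inj₁ (refl , refl)) | refl = h
    ... | yes (inj₂ (refl , refl)) | refl = Any.map (trans (c-sym _ _)) h
    ... | no  _ | eq′ = domain-sound e hs eq′

    -- The two memberships might name the colour of `e` by different indices; as the palette has no
    -- repetition, the index is the same and domains can be intersected.
    filter-within : ∀ {e D} xs → Within e D → Within e xs →
                    Within e (filter (λ x → member? Fin._≟_ x D) xs)
    filter-within {D = D} (x ∷ xs) inD (here p) with member? Fin._≟_ x D
    ... | yes _ = here p
    ... | no x∉D = contradiction
      (Any.map (λ q → Unique.lookup-injective κ! _ _ (trans (sym p) q)) inD) x∉D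
    filter-within {D = D} (x ∷ xs) inD (there p) with member? Fin._≟_ x D
    ... | yes _ = there (filter-within xs inD p)
    ... | no  _ = filter-within xs inD p

    restrict-sound : ∀ {fs} e xs → All Holds fs → Within e xs → Within e (restrict (domain fs e) xs)
    restrict-sound {fs} e xs hs w with domain fs e in eq
    ... | nothing = w
    ... | just D  = filter-within xs (domain-sound e hs eq) w

    known-sound : ∀ {fs} e {x} → All Holds fs → known fs e ≡ just x → Vec.lookup κ x ≡ colourOf e
    known-sound {fs} e hs eq with domain fs e in q | eq
    ... | just (x ∷ []) | refl with here p ← domain-sound e hs q = sym p

    transport : ∀ {x y z t p q r} →
      Vec.lookup κ x ≡ p → Vec.lookup κ y ≡ q → Vec.lookup κ z ≡ r →
      Unique (x ∷ y ∷ z ∷ []) →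
      (Unique (p ∷ q ∷ r ∷ []) → Any (t ≡_) (p ∷ q ∷ r ∷ [])) →
      Any (λ d → t ≡ Vec.lookup κ d) (x ∷ y ∷ z ∷ [])
    transport refl refl refl xyz! rep =
      Any.map⁻ (rep (Unique.map⁺ (Unique.lookup-injective κ! _ _) xyz!))

    narrow-sound : ∀ {fs} e₁ e₂ e₃ e → All Holds fs →
      (Unique (colourOf e₁ ∷ colourOf e₂ ∷ colourOf e₃ ∷ []) →
       Any (colourOf e ≡_) (colourOf e₁ ∷ colourOf e₂ ∷ colourOf e₃ ∷ [])) →
      All Holds (narrow fs e₁ e₂ e₃ e)
    narrow-sound {fs} e₁ e₂ e₃ e hs rep
      with known fs e₁ in q₁ | known fs e₂ in q₂ | known fs e₃ in q₃
    ... | nothing | _       | _       = hs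
    ... | just _  | nothing | _       = hs
    ... | just _  | just _  | nothing = hs
    ... | just x  | just y  | just z with unique? Fin._≟_ (x ∷ y ∷ z ∷ [])
    ...   | no  _    = hs
    ...   | yes xyz! = restrict-sound e _ hs (transport
      (known-sound e₁ hs q₁) (known-sound e₂ hs q₂) (known-sound e₃ hs q₃) xyz! rep) ∷ hs

    infer-sound : ∀ {fs} s → All Holds fs → All Holds (infer fs s)
    infer-sound (end v₀ v₁ v₂ v₃ v₄) hs with unique? Fin._≟_ (v₀ ∷ v₁ ∷ v₂ ∷ v₃ ∷ v₄ ∷ [])
    ... | yes vs! = narrow-sound (v₀ , v₁) (v₁ , v₂) (v₂ , v₃) (v₃ , v₄) hs
      (repeats-end (Unique.map⁺ (Unique.lookup-injective ν! _ _) vs!))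
    ... | no  _ = hs
    infer-sound (inner v₀ v₁ v₂ v₃ v₄) hs with unique? Fin._≟_ (v₀ ∷ v₁ ∷ v₂ ∷ v₃ ∷ v₄ ∷ [])
    ... | yes vs! = narrow-sound (v₀ , v₁) (v₁ , v₂) (v₃ , v₄) (v₂ , v₃) hs
      (repeats-inner (Unique.map⁺ (Unique.lookup-injective ν! _ _) vs!))
    ... | no  _ = hs

    propagate : ∀ {fs} ss → All Holds fs → All Holds (foldl infer fs ss)
    propagate []       hs = hs
    propagate (s ∷ ss) hs = propagate ss (infer-sound s hs)

    -- Abstract because unfolding its uses on open terms is very slow.
    abstract
      refute : ∀ fs ss {e gs} → All Holds fs → foldl infer fs ss ≡ (e , []) ∷ gs → ⊥
      refute fs ss hs eq with () ∷ _ ← subst (All Holds) eq (propagate ss hs)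

  open Soundness using (refute)

  -- In the refutations below, numerals stand for positions in the given lists
  -- of vertices and colours; each step lists the vertices of a path.

  spider-end : ∀ {x a u v w} →
    Unique (x ∷ a ∷ u ∷ v ∷ w ∷ []) →
    Unique (c a x ∷ c a u ∷ c u v ∷ c v w ∷ []) →
    ⊥
  spider-end vs! cs! =
    let x = 0F; a = 1F; u = 2F; v = 3F; w = 4F in
    refute _ vs! _ cs!
      (coloured a x 0F ∷ coloured a u 1F ∷ coloured u v 2F ∷ coloured v w 3F ∷ [])
      (end x a u v w ∷ [])
      (here refl ∷ here refl ∷ here refl ∷ here refl ∷ []) refl

  spider-start : ∀ {x a u v w} →
    Unique (x ∷ a ∷ u ∷ v ∷ w ∷ []) →
    Unique (c a x ∷ c a w ∷ c u v ∷ c v w ∷ []) →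
    ⊥
  spider-start vs! cs! =
    let x = 0F; a = 1F; u = 2F; v = 3F; w = 4F in
    refute _ vs! _ cs!
      (coloured a x 0F ∷ coloured a w 1F ∷ coloured u v 2F ∷ coloured v w 3F ∷ [])
      (end x a w v u ∷ [])
      (here refl ∷ here refl ∷ here refl ∷ here refl ∷ []) refl

  spider-middle : ∀ {a u v x y} →
    Unique (a ∷ u ∷ v ∷ x ∷ y ∷ []) →
    Unique (c a u ∷ c a x ∷ c u v ∷ c x y ∷ []) →
    ⊥
  spider-middle vs! cs! =
    let a = 0F; u = 1F; v = 2F; x = 3F; y = 4F in
    refute _ vs! _ cs!
      (coloured a u 0F ∷ coloured a x 1F ∷ coloured u v 2F ∷ coloured x y 3F ∷ [])
      (end v u a x y ∷ [])
      (here refl ∷ here refl ∷ here refl ∷ here refl ∷ []) refl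

  -- The edge `w u` is forced to the colour of `u v`, and `w x` to that of `x y`; then `z a u w x`
  -- is rainbow.
  refute-disjoint : ∀ {z w a u v x y} →
    Unique (z ∷ w ∷ a ∷ u ∷ v ∷ x ∷ y ∷ []) →
    Unique (c a z ∷ c a w ∷ c a u ∷ c u v ∷ c x y ∷ []) →
    c a v ≡ c a u →
    c a x ≡ c a u →
    c a y ≡ c a u →
    ⊥
  refute-disjoint vs! cs! p₁ p₂ p₃ =
    let z = 0F; w = 1F; a = 2F; u = 3F; v = 4F; x = 5F; y = 6F in
    refute _ vs! _ cs!
      (coloured a z 0F ∷ coloured a w 1F ∷ coloured a u 2F ∷ coloured a v 2F
       ∷ coloured a x 2F ∷ coloured a y 2F ∷ coloured u v 3F ∷ coloured x y 4F ∷ [])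
      (end z a y x w ∷ inner z a w x y ∷ inner u a w x y ∷ end z a v u w
       ∷ inner z a w u v ∷ inner x a w u v ∷ end z a u w x ∷ [])
      (here refl ∷ here refl ∷ here refl ∷ here p₁ ∷ here p₂ ∷ here p₃ ∷ here refl ∷ here refl ∷ []) refl

  -- The edge `x w`, and then `x u`, is forced to the colour of `u v`; this makes `x u a v w`
  -- rainbow.
  refute-unseen : ∀ {x a u v w} →
    Unique (x ∷ a ∷ u ∷ v ∷ w ∷ []) →
    Unique (c a u ∷ c a v ∷ c a w ∷ c u v ∷ c v w ∷ []) →
    c a x ≡ c v w →
    ⊥
  refute-unseen vs! cs! p₁ =
    let x = 0F; a = 1F; u = 2F; v = 3F; w = 4F in
    refute _ vs! _ cs!
      (coloured a u 0F ∷ coloured a v 1F ∷ coloured a w 2F ∷ coloured a x 4F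
       ∷ coloured u v 3F ∷ coloured v w 4F ∷ [])
      (end u v a x w ∷ end v u a x w ∷ end v u a w x ∷ end w a v u x
       ∷ inner v w x u a ∷ end x u a v w ∷ [])
      (here refl ∷ here refl ∷ here refl ∷ here p₁ ∷ here refl ∷ here refl ∷ []) refl

  -- The edge `x y` is forced to the colour of `a v`. The only colour left for `x u` is that of
  -- `a x`, and with it `w v u x y` is rainbow.
  refute-middle-new : ∀ {y x a u v w} →
    Unique (y ∷ x ∷ a ∷ u ∷ v ∷ w ∷ []) →
    Unique (c a y ∷ c a x ∷ c a v ∷ c u v ∷ c v w ∷ []) →
    ⊥
  refute-middle-new vs! cs! =
    let y = 0F; x = 1F; a = 2F; u = 3F; v = 4F; w = 5F in
    refute _ vs! _ cs!
      (coloured a y 0F ∷ coloured a x 1F ∷ coloured a v 2F ∷ coloured u v 3F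
       ∷ coloured v w 4F ∷ [])
      (end u v a x y ∷ end w v a x y ∷ end u v a y x ∷ end w v a x u
       ∷ inner y a x u v ∷ inner w v u x y ∷ [])
      (here refl ∷ here refl ∷ here refl ∷ here refl ∷ here refl ∷ []) refl

  -- The edge `x v` is forced to the colour of `a x`. Then so is `x z`, which makes `w v a z x`
  -- rainbow.
  refute-middle-old : ∀ {z y x a u v w} →
    Unique (z ∷ y ∷ x ∷ a ∷ u ∷ v ∷ w ∷ []) →
    Unique (c a z ∷ c a y ∷ c a x ∷ c u v ∷ c v w ∷ []) →
    c a v ≡ c u v →
    ⊥
  refute-middle-old vs! cs! p₁ =
    let z = 0F; y = 1F; x = 2F; a = 3F; u = 4F; v = 5F; w = 6F in
    refute _ vs! _ cs!
      (coloured a z 0F ∷ coloured a y 1F ∷ coloured a x 2F ∷ coloured a v 3F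
       ∷ coloured u v 3F ∷ coloured v w 4F ∷ [])
      (inner y a x v w ∷ inner z a x v w ∷ inner y a x v u ∷ inner w v x z a
       ∷ inner u v x z a ∷ end w v a x z ∷ end w v a z x ∷ [])
      (here refl ∷ here refl ∷ here refl ∷ here p₁ ∷ here refl ∷ here refl ∷ []) refl

  -- The edge `w x` is forced to the colour of `u v`, and `u y` to that of `v w`; then `x w a u y`
  -- is rainbow.
  refute-all-distinct : ∀ {y x a u v w} →
    Unique (y ∷ x ∷ a ∷ u ∷ v ∷ w ∷ []) →
    Unique (c a u ∷ c a v ∷ c a w ∷ c u v ∷ c v w ∷ []) →
    c a x ≡ c u v →
    c a y ≡ c v w →
    ⊥
  refute-all-distinct vs! cs! p₁ p₂ =
    let y = 0F; x = 1F; a = 2F; u = 3F; v = 4F; w = 5F in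
    refute _ vs! _ cs!
      (coloured a y 4F ∷ coloured a x 3F ∷ coloured a u 0F ∷ coloured a v 1F
       ∷ coloured a w 2F ∷ coloured u v 3F ∷ coloured v w 4F ∷ [])
      (end v u a w x ∷ end u v a w x ∷ end a u v w x ∷ end v w a u y
       ∷ end w v a u y ∷ end a w v u y ∷ end x w a u y ∷ [])
      (here p₂ ∷ here p₁ ∷ here refl ∷ here refl ∷ here refl ∷ here refl ∷ here refl ∷ []) refl

fresh : ∀ {n} (xs : List (Fin n)) → length xs < n → ∃[ y ] All (y ≢_) xs
fresh {n} xs short with Fin.all? (λ y → member? Fin._≟_ y xs)
... | yes all∈ = contradiction
  (Fin.injective⇒≤ {f = λ y → Any.index (all∈ y)}
    (Membership.index-injective (setoid (Fin n)) (all∈ _) (all∈ _)))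
  (ℕ.<⇒≱ short)
... | no ¬all∈ =
  let y , y∉ = Fin.¬∀⟶∃¬ n _ (λ y → member? Fin._≟_ y xs) ¬all∈ in y , All.¬Any⇒All¬ xs y∉

-- Colourings without a rainbow path of order five

module Structure {n k} (5≤n : 5 ≤ n) (5≤k : 5 ≤ k)
                 (c : Fin n → Fin n → Fin k) (c-sym : ∀ u v → c u v ≡ c v u)
                 (noRainbow : ∀ vs → ¬ RainbowPath c vs) where

  open Propagation Fin._≟_ c-sym noRainbow

  newColour : ∀ κ₁ κ₂ κ₃ κ₄ → ∃[ κ ] κ ≢ κ₁ × κ ≢ κ₂ × κ ≢ κ₃ × κ ≢ κ₄
  newColour κ₁ κ₂ κ₃ κ₄ with fresh (κ₁ ∷ κ₂ ∷ κ₃ ∷ κ₄ ∷ []) 5≤k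
  ... | κ , p ∷ q ∷ r ∷ s ∷ _ = κ , p , q , r , s

  module AtVertex (a : Fin n) where

    apart : ∀ {x y κ} → c a x ≢ κ → c a y ≡ κ → x ≢ y
    apart ne eq refl = ne eq

    Triple : (u v w : Fin n) → Set
    Triple u v w = Unique (a ∷ u ∷ v ∷ w ∷ [])

    triple : ∀ {u v w} → u ≢ a → v ≢ a → w ≢ a → u ≢ v → u ≢ w → v ≢ w → Triple u v w
    triple u≢a v≢a w≢a u≢v u≢w v≢w =
      (u≢a ∘ sym ∷ v≢a ∘ sym ∷ w≢a ∘ sym ∷ []) ∷ (u≢v ∷ u≢w ∷ []) ∷ (v≢w ∷ []) ∷ [] ∷ []

    reverse : ∀ {u v w} → Triple u v w → Triple w v u
    reverse ((au ∷ av ∷ aw ∷ []) ∷ (uv ∷ uw ∷ []) ∷ (vw ∷ []) ∷ [] ∷ []) =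
      (aw ∷ av ∷ au ∷ []) ∷ (vw ∘ sym ∷ uw ∘ sym ∷ []) ∷ (uv ∘ sym ∷ []) ∷ [] ∷ []

    Seen : Fin k → Set
    Seen κ = ∃[ x ] x ≢ a × c a x ≡ κ

    -- At least three, respectively four, colours occur at a.
    Rich₃ : Set
    Rich₃ = ∀ κ₁ κ₂ → ∃[ x ] x ≢ a × c a x ≢ κ₁ × c a x ≢ κ₂

    Rich₄ : Set
    Rich₄ = ∀ κ₁ κ₂ κ₃ → ∃[ x ] x ≢ a × c a x ≢ κ₁ × c a x ≢ κ₂ × c a x ≢ κ₃

    seen? : ∀ κ → Dec (Seen κ)
    seen? κ = Fin.any? λ x → ¬? (x Fin.≟ a) ×-dec (c a x Fin.≟ κ)

    rich₃? : Dec Rich₃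
    rich₃? = Fin.all? λ κ₁ → Fin.all? λ κ₂ → Fin.any? λ x →
      ¬? (x Fin.≟ a) ×-dec ¬? (c a x Fin.≟ κ₁) ×-dec ¬? (c a x Fin.≟ κ₂)

    MonochromaticOff : Fin k → Set
    MonochromaticOff γ = ∀ x y → x ≢ a → y ≢ a → x ≢ y → c x y ≡ γ

    -- Every edge `x y` off `a` is reached from `u v` by the walk `u v x y`, so it suffices that `γ`
    -- passes between touching edges.
    connected : ∀ {γ u v} → u ≢ a → v ≢ a → u ≢ v → c u v ≡ γ →
      (∀ {u v w} → Triple u v w → c u v ≡ γ → c v w ≡ γ) → MonochromaticOff γ
    connected {γ} {u} {v} u≢a v≢a u≢v uv spread x y x≢a y≢a x≢y =
      case-x (v Fin.≟ x)
      where
      step : ∀ {u v} → u ≢ a → v ≢ a → u ≢ v → c u v ≡ γ → ∀ w → w ≢ a → v ≢ w → c v w ≡ γ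
      step {u} {v} u≢a v≢a u≢v uv w w≢a v≢w with u Fin.≟ w
      ... | yes refl = trans (c-sym v u) uv
      ... | no u≢w   = spread (triple u≢a v≢a w≢a u≢v u≢w v≢w) uv

      case-x : Dec (v ≡ x) → c x y ≡ γ
      case-x (yes refl) = step u≢a v≢a u≢v uv y y≢a x≢y
      case-x (no v≢x)   = step v≢a x≢a v≢x (step u≢a v≢a u≢v uv x x≢a v≢x) y y≢a x≢y

    module OneUnseen (rich : Rich₄) {γ} (unseen : ∀ x → x ≢ a → c a x ≢ γ) where

      -- If `a u` has another colour, any `x` outside the triple whose colour at `a` differs from
      -- those of `a u` and `v w` makes `x a u v w` rainbow. The further colours promised by `rich`
      -- must then sit at `v` and `w`, which `refute-unseen` excludes.
      start-colour : ∀ {u v w} → Triple u v w → c u v ≡ γ → c v w ≢ γ → c a u ≡ c v w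
      start-colour {u} {v} {w} t@((au ∷ av ∷ aw ∷ []) ∷ (uv ∷ uw ∷ []) ∷ (vw ∷ []) ∷ [] ∷ []) refl δ≢γ =
        decidable-stable (c a u Fin.≟ c v w) refuted
        where
        module _ (u≢δ : c a u ≢ c v w) where
          outside : ∀ {x} → x ≢ a → x ≢ v → x ≢ w → c a x ≢ c a u → c a x ≡ c v w
          outside {x} xa xv xw xu = decidable-stable (c a x Fin.≟ c v w) λ x≢δ →
            spider-end ((xa ∷ apart xu refl ∷ xv ∷ xw ∷ []) ∷ t)
              ((xu ∷ unseen x xa ∷ x≢δ ∷ []) ∷ (unseen u (au ∘ sym) ∷ u≢δ ∷ [])
               ∷ (δ≢γ ∘ sym ∷ []) ∷ [] ∷ [])

          w-new : c a w ≢ c a u × c a w ≢ c v w × c a w ≢ c a v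
          w-new with x , xa , p , q , r ← rich (c a u) (c v w) (c a v) with x Fin.≟ w
          ... | yes refl = p , q , r
          ... | no xw    = contradiction (outside xa (apart r refl) xw p) q

          v-new : c a v ≢ c a u × c a v ≢ c v w × c a v ≢ c a w
          v-new with x , xa , p , q , r ← rich (c a u) (c v w) (c a w) with x Fin.≟ v
          ... | yes refl = p , q , r
          ... | no xv    = contradiction (outside xa xv (apart r refl) p) q

          refuted : ⊥
          refuted =
            let x , xa , p , q , r = rich (c a u) (c a v) (c a w)
                wu , wδ , _ = w-new
                vu , vδ , vw′ = v-new
                xv = apart q refl
                xw = apart r refl
            in refute-unseen ((xa ∷ apart p refl ∷ xv ∷ xw ∷ []) ∷ t)
                 ((vu ∘ sym ∷ wu ∘ sym ∷ unseen u (au ∘ sym) ∷ u≢δ ∷ [])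
                  ∷ (vw′ ∷ unseen v (av ∘ sym) ∷ vδ ∷ [])
                  ∷ (unseen w (aw ∘ sym) ∷ wδ ∷ []) ∷ (δ≢γ ∘ sym ∷ []) ∷ [] ∷ [])
                 (outside xa xv xw p)

      end-colour : ∀ {u v w} → Triple u v w → c u v ≡ γ → c v w ≢ γ → c a w ≡ c v w
      end-colour {u} {v} {w} t@((au ∷ av ∷ aw ∷ []) ∷ _) uv δ≢γ =
        decidable-stable (c a w Fin.≟ c v w) λ w≢δ →
          let x , xa , p , q , r = rich (c a w) (c v w) (c a v)
          in spider-start
               ((xa ∷ apart q (start-colour t uv δ≢γ) ∷ apart r refl ∷ apart p refl ∷ []) ∷ t)
               ((p ∷ (λ e → unseen x xa (trans e uv)) ∷ q ∷ [])
                ∷ ((λ e → unseen w (aw ∘ sym) (trans e uv)) ∷ w≢δ ∷ [])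
                ∷ ((λ e → δ≢γ (trans (sym e) uv)) ∷ []) ∷ [] ∷ [])

      -- If `v w` had a colour `δ` other than `γ`, both `u` and `w` would be joined to `a` in `δ`.
      -- Take `x` joined to `a` neither in `δ` nor in the colour of `a v`. If `v x` has colour `γ`,
      -- the triple `x v w` gives `a x` the colour `δ`; otherwise the triple `u v x` gives `a x` the
      -- colour of `a u`, again `δ`.
      spread : ∀ {u v w} → Triple u v w → c u v ≡ γ → c v w ≡ γ
      spread {u} {v} {w} t@((au ∷ av ∷ aw ∷ []) ∷ (uv ∷ uw ∷ []) ∷ (vw ∷ []) ∷ [] ∷ []) eq =
        decidable-stable (c v w Fin.≟ γ) λ δ≢γ →
          let x , xa , p , q , _ = rich (c v w) (c a v) (c a v)
              u-δ = start-colour t eq δ≢γ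
              xu  = apart p u-δ
              xv  = apart q refl
              xw  = apart p (end-colour t eq δ≢γ)
              va  = av ∘ sym
              tx  = triple (au ∘ sym) va xa uv (xu ∘ sym) (xv ∘ sym)
          in case (c v x Fin.≟ γ) of λ where
            (yes vx) → p (start-colour (triple xa va (aw ∘ sym) xv xw vw)
                                       (trans (c-sym x v) vx) δ≢γ)
            (no vx)  → p (trans (end-colour tx eq vx) (trans (sym (start-colour tx eq vx)) u-δ))


    module AllSeen (seen : ∀ κ → Seen κ) where

      newNeighbour : ∀ κ₁ κ₂ κ₃ κ₄ →
        ∃[ x ] x ≢ a × c a x ≢ κ₁ × c a x ≢ κ₂ × c a x ≢ κ₃ × c a x ≢ κ₄
      newNeighbour κ₁ κ₂ κ₃ κ₄
        with κ , new ← newColour κ₁ κ₂ κ₃ κ₄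
        with x , xa , refl ← seen κ
        = x , xa , new

      -- If `a u` had a new colour, the paths `x a u v w` would leave all further new colours at `a`
      -- to `v` and `w`. With five colours both of these are new and distinct, so the colours of
      -- `u v` and `v w` are seen at `a` on vertices outside the triple.
      first-old : ∀ {u v w} → Triple u v w → c u v ≢ c v w → c a u ≡ c u v ⊎ c a u ≡ c v w
      first-old {u} {v} {w} t α≢β =
        decidable-stable ((c a u Fin.≟ c u v) ⊎-dec (c a u Fin.≟ c v w))
          λ u-new → refuted (u-new ∘ inj₁) (u-new ∘ inj₂)
        where
        module _ (u≢α : c a u ≢ c u v) (u≢β : c a u ≢ c v w) where
          outside : ∀ {x} → x ≢ a → x ≢ v → x ≢ w →
                    c a x ≢ c a u → c a x ≢ c u v → c a x ≢ c v w → ⊥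
          outside xa xv xw xu xα xβ =
            spider-end ((xa ∷ apart xu refl ∷ xv ∷ xw ∷ []) ∷ t)
              ((xu ∷ xα ∷ xβ ∷ []) ∷ (u≢α ∷ u≢β ∷ []) ∷ (α≢β ∷ []) ∷ [] ∷ [])

          w-new : c a w ≢ c a u × c a w ≢ c u v × c a w ≢ c v w × c a w ≢ c a v
          w-new with x , xa , p , q , r , s ← newNeighbour (c a u) (c u v) (c v w) (c a v)
                with x Fin.≟ w
          ... | yes refl = p , q , r , s
          ... | no xw    = ⊥-elim (outside xa (apart s refl) xw p q r)

          v-new : c a v ≢ c a u × c a v ≢ c u v × c a v ≢ c v w
          v-new with x , xa , p , q , r , s ← newNeighbour (c a u) (c u v) (c v w) (c a w)
                with x Fin.≟ v
          ... | yes refl = p , q , r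
          ... | no xv    = ⊥-elim (outside xa xv (apart s refl) p q r)

          refuted : ⊥
          refuted =
            let wu , wα , wβ , wv = w-new
                vu , vα , vβ      = v-new
                x , xa , xα       = seen (c u v)
                y , ya , yβ       = seen (c v w)
                differ : ∀ {z z′ κ} → c a z ≢ κ → c a z′ ≡ κ → z′ ≢ z
                differ p q = apart p q ∘ sym
            in refute-all-distinct
                 ((apart (λ e → α≢β (trans (sym e) yβ)) xα
                   ∷ ya ∷ differ u≢β yβ ∷ differ vβ yβ ∷ differ wβ yβ ∷ [])
                  ∷ (xa ∷ differ u≢α xα ∷ differ vα xα ∷ differ wα xα ∷ []) ∷ t)
                 ((vu ∘ sym ∷ wu ∘ sym ∷ u≢α ∷ u≢β ∷ [])
                  ∷ (wv ∘ sym ∷ vα ∷ vβ ∷ []) ∷ (wα ∷ wβ ∷ []) ∷ (α≢β ∷ []) ∷ [] ∷ [])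
                 xα yβ

      last-old : ∀ {u v w} → Triple u v w → c u v ≢ c v w → c a w ≡ c u v ⊎ c a w ≡ c v w
      last-old {u} {v} {w} t α≢β =
        Sum.map (λ e → trans e (c-sym v u)) (λ e → trans e (c-sym w v))
          (Sum.swap (first-old (reverse t)
            λ e → α≢β (trans (c-sym u v) (trans (sym e) (c-sym w v)))))

      avoids : ∀ {x y α β} → c a y ≡ α ⊎ c a y ≡ β → c a x ≢ α → c a x ≢ β → x ≢ y
      avoids (inj₁ e) xα xβ = apart xα e
      avoids (inj₂ e) xα xβ = apart xβ e

      -- Otherwise all of `u`, `v`, `w` are joined to `a` in the two old colours, so the three
      -- remaining colours lead from `a` to vertices outside the triple.
      middle-new : ∀ {u v w} → Triple u v w → c u v ≢ c v w → c a v ≢ c u v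
      middle-new {u} {v} {w} t α≢β v-α =
        let u-old = first-old t α≢β
            w-old = last-old t α≢β
            x , xa , p , q , _        = newNeighbour (c u v) (c v w) (c v w) (c v w)
            y , ya , p′ , q′ , r′ , _ = newNeighbour (c u v) (c v w) (c a x) (c a x)
            z , za , p″ , q″ , r″ , s = newNeighbour (c u v) (c v w) (c a x) (c a y)
        in refute-middle-old
            ((apart s refl ∷ apart r″ refl ∷ za ∷ avoids u-old p″ q″ ∷ apart p″ v-α ∷ avoids w-old p″ q″ ∷ [])
             ∷ (apart r′ refl ∷ ya ∷ avoids u-old p′ q′ ∷ apart p′ v-α ∷ avoids w-old p′ q′ ∷ [])
             ∷ (xa ∷ avoids u-old p q ∷ apart p v-α ∷ avoids w-old p q ∷ []) ∷ t)
            ((s ∷ r″ ∷ p″ ∷ q″ ∷ []) ∷ (r′ ∷ p′ ∷ q′ ∷ []) ∷ (p ∷ q ∷ []) ∷ (α≢β ∷ []) ∷ [] ∷ [])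
            v-α

      adjacent-agree : ∀ {u v w} → Triple u v w → c u v ≡ c v w
      adjacent-agree {u} {v} {w} t = decidable-stable (c u v Fin.≟ c v w) λ α≢β →
        let u-old = first-old t α≢β
            w-old = last-old t α≢β
            v-α   = middle-new t α≢β
            v-β   = λ e → middle-new (reverse t)
              (λ e′ → α≢β (trans (c-sym u v) (trans (sym e′) (c-sym w v)))) (trans e (c-sym v w))
            -- With the colours of `u v`, `v w` and `a v`, the colours of `a x` and `a y` make five.
            x , xa , p , q , r , _      = newNeighbour (c u v) (c v w) (c a v) (c a v)
            y , ya , p′ , q′ , r′ , s′ = newNeighbour (c u v) (c v w) (c a v) (c a x)
        in refute-middle-new
            ((apart s′ refl ∷ ya ∷ avoids u-old p′ q′ ∷ apart r′ refl ∷ avoids w-old p′ q′ ∷ [])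
             ∷ (xa ∷ avoids u-old p q ∷ apart r refl ∷ avoids w-old p q ∷ []) ∷ t)
            ((s′ ∷ r′ ∷ p′ ∷ q′ ∷ []) ∷ (r ∷ p ∷ q ∷ []) ∷ (v-α ∷ v-β ∷ []) ∷ (α≢β ∷ []) ∷ [] ∷ [])

    module TwoUnseen (rich : Rich₃) {γ δ} (γ≢δ : γ ≢ δ)
                     (γ-unseen : ∀ x → x ≢ a → c a x ≢ γ)
                     (δ-unseen : ∀ x → x ≢ a → c a x ≢ δ) where

      -- By the paths `x a u v w`, all vertices other than `v` and `w` are joined to `a` in the
      -- colour of `a u`. A fifth vertex `y`, through `y a w v u`, brings in `w`, so only `v` can
      -- differ and `a` has at most two colours.
      ¬adjacent : ∀ {u v w} → Triple u v w → c u v ≡ γ → c v w ≡ δ → ⊥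
      ¬adjacent {u} {v} {w} t@((au ∷ av ∷ aw ∷ []) ∷ _) refl refl =
        case fresh (a ∷ u ∷ v ∷ w ∷ []) 5≤n of λ where
          (y , ya ∷ yu ∷ yv ∷ yw ∷ _) →
            let ua = au ∘ sym
                wa = aw ∘ sym
                like-u : ∀ {x} → x ≢ a → x ≢ v → x ≢ w → c a x ≡ c a u
                like-u {x} xa xv xw = decidable-stable (c a x Fin.≟ c a u) λ x≢u →
                  spider-end ((xa ∷ apart x≢u refl ∷ xv ∷ xw ∷ []) ∷ t)
                    ((x≢u ∷ γ-unseen x xa ∷ δ-unseen x xa ∷ [])
                     ∷ (γ-unseen u ua ∷ δ-unseen u ua ∷ []) ∷ (γ≢δ ∷ []) ∷ [] ∷ [])
                y-w : c a y ≡ c a w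
                y-w = decidable-stable (c a y Fin.≟ c a w) λ y≢w →
                  spider-start ((ya ∷ yu ∷ yv ∷ yw ∷ []) ∷ t)
                    ((y≢w ∷ γ-unseen y ya ∷ δ-unseen y ya ∷ [])
                     ∷ (γ-unseen w wa ∷ δ-unseen w wa ∷ []) ∷ (γ≢δ ∷ []) ∷ [] ∷ [])
                x , xa , p , q = rich (c a u) (c a v)
                w-u = trans (sym y-w) (like-u ya yv yw)
            in p (like-u xa (apart q refl) (apart p w-u))

      -- The path `v u a x y` and its variants with ends swapped force all four ends to have one
      -- colour at `a`; two further colours at `a` then lead to other vertices.
      ¬disjoint : ∀ {u v x y} → Unique (a ∷ u ∷ v ∷ x ∷ y ∷ []) → c u v ≡ γ → c x y ≡ δ → ⊥
      ¬disjoint {u} {v} {x} {y}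
        vs!@((au ∷ av ∷ ax ∷ ay ∷ []) ∷ (uv ∷ ux ∷ uy ∷ []) ∷ (vx ∷ vy ∷ []) ∷ (xy ∷ []) ∷ [] ∷ []) p q =
        let z , za , zu , _  = rich (c a u) (c a u)
            w , wa , wu , wz = rich (c a u) (c a z)
        in refute-disjoint
            ((apart wz refl ∘ sym ∷ za ∷ apart zu refl ∷ apart zu v-u ∷ apart zu x-u ∷ apart zu y-u ∷ [])
             ∷ (wa ∷ apart wu refl ∷ apart wu v-u ∷ apart wu x-u ∷ apart wu y-u ∷ []) ∷ vs!)
            ((wz ∘ sym ∷ zu ∷ ¬γ za p ∷ ¬δ za q ∷ [])
             ∷ (wu ∷ ¬γ wa p ∷ ¬δ wa q ∷ [])
             ∷ (¬γ (au ∘ sym) p ∷ ¬δ (au ∘ sym) q ∷ []) ∷ (differ p q ∷ []) ∷ [] ∷ [])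
            v-u x-u y-u
        where
        ¬γ : ∀ {x κ} → x ≢ a → κ ≡ γ → c a x ≢ κ
        ¬γ xa refl = γ-unseen _ xa
        ¬δ : ∀ {x κ} → x ≢ a → κ ≡ δ → c a x ≢ κ
        ¬δ xa refl = δ-unseen _ xa
        differ : ∀ {κ λ′} → κ ≡ γ → λ′ ≡ δ → κ ≢ λ′
        differ refl refl = γ≢δ
        agree : ∀ {u v x y} → Unique (a ∷ u ∷ v ∷ x ∷ y ∷ []) → c u v ≡ γ → c x y ≡ δ → c a u ≡ c a x
        agree {u} {x = x} vs!@((au ∷ _ ∷ ax ∷ _) ∷ _) p q =
          decidable-stable (c a u Fin.≟ c a x) λ u≢x →
            spider-middle vs!
              ((u≢x ∷ ¬γ (au ∘ sym) p ∷ ¬δ (au ∘ sym) q ∷ [])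
               ∷ (¬γ (ax ∘ sym) p ∷ ¬δ (ax ∘ sym) q ∷ []) ∷ (differ p q ∷ []) ∷ [] ∷ [])
        x-u = sym (agree vs! p q)
        y-u = sym (agree {u} {v} {y} {x}
          ((au ∷ av ∷ ay ∷ ax ∷ []) ∷ (uv ∷ uy ∷ ux ∷ []) ∷ (vy ∷ vx ∷ []) ∷ (xy ∘ sym ∷ []) ∷ [] ∷ [])
          p (trans (c-sym y x) q))
        v-u = trans (agree {v} {u} {x} {y}
          ((av ∷ au ∷ ax ∷ ay ∷ []) ∷ (uv ∘ sym ∷ vx ∷ vy ∷ []) ∷ (ux ∷ uy ∷ []) ∷ (xy ∷ []) ∷ [] ∷ [])
          (trans (c-sym v u) p) q) x-u

      impossible : (∀ κ → ∃[ u ] ∃[ v ] u ≢ v × c u v ≡ κ) → ⊥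
      impossible exact
        with u , v , uv , p ← exact γ
        with x , y , xy , q ← exact δ
        = cases
        where
        endpoints : ∀ {u v κ} → u ≢ v → c u v ≡ κ → (∀ x → x ≢ a → c a x ≢ κ) → u ≢ a
        endpoints {v = v} uv p unseen refl = unseen v (uv ∘ sym) p
        ua = endpoints uv p γ-unseen
        va = endpoints (uv ∘ sym) (trans (c-sym v u) p) γ-unseen
        xa = endpoints xy q δ-unseen
        ya = endpoints (xy ∘ sym) (trans (c-sym y x) q) δ-unseen

        meet : ∀ {u v w} → u ≢ a → v ≢ a → w ≢ a → u ≢ v → v ≢ w → c u v ≡ γ → c v w ≡ δ → ⊥
        meet {u} {v} {w} ua va wa uv vw p q with u Fin.≟ w
        ... | yes refl = γ≢δ (trans (sym p) (trans (c-sym u v) q))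
        ... | no uw    = ¬adjacent (triple ua va wa uv uw vw) p q

        cases : ⊥
        cases with v Fin.≟ x | v Fin.≟ y | u Fin.≟ x | u Fin.≟ y
        ... | yes refl | _ | _ | _ = meet ua va ya uv xy p q
        ... | _ | yes refl | _ | _ = meet ua va xa uv (xy ∘ sym) p (trans (c-sym y x) q)
        ... | _ | _ | yes refl | _ = meet va ua ya (uv ∘ sym) xy (trans (c-sym v u) p) q
        ... | _ | _ | _ | yes refl =
          meet va ua xa (uv ∘ sym) (xy ∘ sym) (trans (c-sym v u) p) (trans (c-sym y x) q)
        ... | no vx | no vy | no ux | no uy =
          ¬disjoint ((ua ∘ sym ∷ va ∘ sym ∷ xa ∘ sym ∷ ya ∘ sym ∷ [])
                     ∷ (uv ∷ ux ∷ uy ∷ []) ∷ (vx ∷ vy ∷ []) ∷ (xy ∷ []) ∷ [] ∷ []) p q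

    rich⇒monochromaticOff : Rich₃ → (∀ κ → ∃[ u ] ∃[ v ] u ≢ v × c u v ≡ κ) →
                            ∃[ γ ] MonochromaticOff γ
    rich⇒monochromaticOff rich exact with Fin.all? seen?
    ... | yes seen
      with u , ua ∷ _ ← fresh (a ∷ []) (ℕ.≤-trans (s≤s (s≤s z≤n)) 5≤n)
      with v , va ∷ vu ∷ _ ← fresh (a ∷ u ∷ []) (ℕ.≤-trans (s≤s (s≤s (s≤s z≤n))) 5≤n)
      = c u v , connected ua va (vu ∘ sym) refl λ t p → trans (sym (AllSeen.adjacent-agree seen t)) p
    ... | no ¬seen
      with γ , γ-unseen ← Fin.¬∀⟶∃¬ k Seen seen? ¬seen
      = γ , mono
      where
      none : ∀ {κ} → ¬ Seen κ → ∀ x → x ≢ a → c a x ≢ κ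
      none ¬s x xa p = ¬s (x , xa , p)

      others-seen : ∀ {κ} → κ ≢ γ → Seen κ
      others-seen {κ} κ≢γ = decidable-stable (seen? κ) λ κ-unseen →
        TwoUnseen.impossible rich (κ≢γ ∘ sym) (none γ-unseen) (none κ-unseen) exact

      rich₄ : Rich₄
      rich₄ κ₁ κ₂ κ₃
        with κ , p , q , r , s ← newColour κ₁ κ₂ κ₃ γ
        with x , xa , refl ← others-seen s
        = x , xa , p , q , r

      mono : MonochromaticOff γ
      mono with u , v , uv , p ← exact γ =
        connected
          (λ { refl → none γ-unseen v (uv ∘ sym) p })
          (λ { refl → none γ-unseen u uv (trans (c-sym v u) p) }) uv p
          (OneUnseen.spread rich₄ (none γ-unseen))

-- Counting with lists without repetition

lookup-injective : ∀ {A : Set} {xs : List A} → List.Unique xs → ∀ i j → lookup xs i ≡ lookup xs j → i ≡ j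
lookup-injective (_ ∷ _)    zero    zero    _  = refl
lookup-injective (x∉ ∷ _)   zero    (suc j) eq = contradiction eq (All.lookup x∉ (∈.∈-lookup j))
lookup-injective (x∉ ∷ _)   (suc i) zero    eq = contradiction (sym eq) (All.lookup x∉ (∈.∈-lookup i))
lookup-injective (_ ∷ xs!)  (suc i) (suc j) eq = cong suc (lookup-injective xs! i j eq)

unique-⊆⇒length≤ : ∀ {A : Set} {xs ys : List A} → List.Unique xs → (∀ {x} → x ∈ xs → x ∈ ys) →
                   length xs ≤ length ys
unique-⊆⇒length≤ {A} xs! xs⊆ys = Fin.injective⇒≤ {f = λ i → Any.index (xs⊆ys (∈.∈-lookup i))}
  λ {i} {j} eq → lookup-injective xs! i j
    (Membership.index-injective (setoid A) (xs⊆ys (∈.∈-lookup i)) (xs⊆ys (∈.∈-lookup j)) eq)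

unique⇒length≤ : ∀ {n} {xs : List (Fin n)} → List.Unique xs → length xs ≤ n
unique⇒length≤ {n} {xs} xs! = subst (length xs ≤_) (List.length-tabulate {n = n} (λ i → i))
  (unique-⊆⇒length≤ xs! (λ _ → ∈.∈-allFin _))

module _ {A : Set} {P : Pred A 0ℓ} (P? : Decidable P) where
  length-filter-¬ : ∀ xs → length (filter P? xs) + length (filter (¬? ∘ P?) xs) ≡ length xs
  length-filter-¬ [] = refl
  length-filter-¬ (x ∷ xs) with P? x
  ... | yes _ = cong suc (length-filter-¬ xs)
  ... | no  _ = trans (ℕ.+-suc _ _) (cong suc (length-filter-¬ xs))

length-concat-≥ : ∀ {A : Set} {b} {xss : List (List A)} → All (λ xs → b ≤ length xs) xss →
                  length xss * b ≤ length (concat xss)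
length-concat-≥ [] = z≤n
length-concat-≥ {b = b} {xs ∷ xss} (b≤ ∷ bs) =
  subst (b + length xss * b ≤_) (sym (List.length-++ xs)) (ℕ.+-mono-≤ b≤ (length-concat-≥ bs))

-- Colourings with at most two colours at each vertex

module Dominance {n k} (5≤k : 5 ≤ k)
                 (c : Fin n → Fin n → Fin k) (c-sym : ∀ u v → c u v ≡ c v u)
                 (exact : ∀ κ → ∃[ u ] ∃[ v ] u ≢ v × c u v ≡ κ)
                 (two : ∀ a → ∃[ κ₁ ] ∃[ κ₂ ] ∀ x → x ≢ a → c a x ≡ κ₁ ⊎ c a x ≡ κ₂) where

  among : ∀ {a x κ₁ κ₂} → x ≢ a → κ₁ ≢ κ₂ →
          ∃[ y ] y ≢ a × c a y ≡ κ₁ → ∃[ z ] z ≢ a × c a z ≡ κ₂ → c a x ≡ κ₁ ⊎ c a x ≡ κ₂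
  among {a} {x} xa κ₁≢κ₂ (y , ya , refl) (z , za , refl)
    with λ₁ , λ₂ , bound ← two a
    with bound x xa | bound y ya | bound z za
  ... | inj₁ x₁ | inj₁ y₁ | _       = inj₁ (trans x₁ (sym y₁))
  ... | inj₂ x₂ | inj₂ y₂ | _       = inj₁ (trans x₂ (sym y₂))
  ... | inj₁ x₁ | _       | inj₁ z₁ = inj₂ (trans x₁ (sym z₁))
  ... | inj₂ x₂ | _       | inj₂ z₂ = inj₂ (trans x₂ (sym z₂))
  ... | inj₁ _  | inj₂ y₂ | inj₂ z₂ = contradiction (trans y₂ (sym z₂)) κ₁≢κ₂
  ... | inj₂ _  | inj₁ y₁ | inj₁ z₁ = contradiction (trans y₁ (sym z₁)) κ₁≢κ₂

  not-first : ∀ {a x κ₁ κ₂} → x ≢ a → κ₁ ≢ κ₂ →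
              ∃[ y ] y ≢ a × c a y ≡ κ₁ → ∃[ z ] z ≢ a × c a z ≡ κ₂ → c a x ≢ κ₁ → c a x ≡ κ₂
  not-first xa κ₁≢κ₂ y z x≢κ₁ with among xa κ₁≢κ₂ y z
  ... | inj₁ p = contradiction p x≢κ₁
  ... | inj₂ p = p

  -- Pairwise intersecting sets of size at most two whose union has at least
  -- four elements have a common element; here the sets of colours at the vertices.
  commonColour : ∃[ α ] (∀ x → ∃[ y ] y ≢ x × c x y ≡ α)
  commonColour
    with v , _ ← exact (fromℕ< (ℕ.≤-trans (s≤s z≤n) 5≤k))
    with α₀ , β₀ , bound ← two v
    with γ , γα₀ ∷ γβ₀ ∷ _ ←
           fresh (α₀ ∷ β₀ ∷ []) (ℕ.≤-trans (s≤s (s≤s (s≤s z≤n))) 5≤k)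
    with u , u′ , uu′ , uγ ← exact γ
    with δ , δα₀ ∷ δβ₀ ∷ δγ ∷ _ ←
           fresh (α₀ ∷ β₀ ∷ γ ∷ []) (ℕ.≤-trans (s≤s (s≤s (s≤s (s≤s z≤n)))) 5≤k)
    with w , w′ , ww′ , wδ ← exact δ
    = α , common
    where
    -- The vertex `v` sees neither `γ` nor `δ`, so `u` sees exactly `α` and `γ`. As `w v` and `w u`
    -- both avoid `δ`, they share the second colour at `w`, which can only be `α`. Any other vertex
    -- missing `α` would see `γ` towards `u` and `δ` towards `w`, leaving no colour towards `v`.
    α = c v u

    off-v : ∀ {κ y z} → κ ≢ α₀ → κ ≢ β₀ → y ≢ z → c y z ≡ κ → y ≢ v
    off-v {z = z} κα₀ κβ₀ yz p refl with bound z (yz ∘ sym)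
    ... | inj₁ q = κα₀ (trans (sym p) q)
    ... | inj₂ q = κβ₀ (trans (sym p) q)

    not-at-v : ∀ {κ x} → κ ≢ α₀ → κ ≢ β₀ → x ≢ v → c v x ≢ κ
    not-at-v {x = x} κα₀ κβ₀ xv refl with bound x xv
    ... | inj₁ q = κα₀ q
    ... | inj₂ q = κβ₀ q

    uv = off-v γα₀ γβ₀ uu′ uγ
    wv = off-v δα₀ δβ₀ ww′ wδ
    αγ = not-at-v γα₀ γβ₀ uv
    αδ = not-at-v δα₀ δβ₀ uv

    α-at-u : ∃[ y ] y ≢ u × c u y ≡ α
    α-at-u = v , uv ∘ sym , c-sym u v
    γ-at-u : ∃[ y ] y ≢ u × c u y ≡ γ
    γ-at-u = u′ , uu′ ∘ sym , uγ
    δ-at-w : ∃[ y ] y ≢ w × c w y ≡ δ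
    δ-at-w = w′ , ww′ ∘ sym , wδ

    wu : w ≢ u
    wu refl with among (ww′ ∘ sym) αγ α-at-u γ-at-u
    ... | inj₁ p = αδ (trans (sym p) wδ)
    ... | inj₂ p = δγ (trans (sym wδ) p)

    wu≢δ : c w u ≢ δ
    wu≢δ p with among wu αγ α-at-u γ-at-u
    ... | inj₁ q = αδ (trans (sym q) (trans (c-sym u w) p))
    ... | inj₂ q = δγ (trans (sym p) (trans (c-sym w u) q))

    wv≡wu : c w v ≡ c w u
    wv≡wu = not-first (wv ∘ sym) (wu≢δ ∘ sym) δ-at-w (u , wu ∘ sym , refl)
      (λ e → not-at-v δα₀ δβ₀ wv (trans (c-sym v w) e))

    wv≡α : c w v ≡ α
    wv≡α with among wu αγ α-at-u γ-at-u
    ... | inj₁ p = trans wv≡wu (trans (c-sym w u) p)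
    ... | inj₂ p = contradiction
      (trans (c-sym v w) (trans wv≡wu (trans (c-sym w u) p))) (not-at-v γα₀ γβ₀ wv)

    α-at-w : ∃[ y ] y ≢ w × c w y ≡ α
    α-at-w = v , wv ∘ sym , wv≡α

    common : ∀ x → ∃[ y ] y ≢ x × c x y ≡ α
    common x with x Fin.≟ v | x Fin.≟ u | x Fin.≟ w
    ... | yes refl | _        | _        = u , uv , refl
    ... | _        | yes refl | _        = α-at-u
    ... | _        | _        | yes refl = α-at-w
    ... | no xv    | no xu    | no xw
      with c x v Fin.≟ α | c x u Fin.≟ α | c x w Fin.≟ α
    ... | yes p | _     | _     = v , xv ∘ sym , p
    ... | _     | yes p | _     = u , xu ∘ sym , p
    ... | _     | _     | yes p = w , xw ∘ sym , p
    ... | no _  | no p  | no q  = ⊥-elim (new (among (xv ∘ sym) (δγ ∘ sym)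
        (u , xu ∘ sym , trans (c-sym x u) (not-first xu αγ α-at-u γ-at-u (p ∘ trans (c-sym x u))))
        (w , xw ∘ sym , trans (c-sym x w) (not-first xw αδ α-at-w δ-at-w (q ∘ trans (c-sym x w))))))
      where
      new : c x v ≡ γ ⊎ c x v ≡ δ → ⊥
      new (inj₁ e) = not-at-v γα₀ γβ₀ xv (trans (c-sym v x) e)
      new (inj₂ e) = not-at-v δα₀ δβ₀ xv (trans (c-sym v x) e)

  -- As `ρ` occurs at every vertex, at most one other colour does; this is the label. A vertex with
  -- only `ρ` is labelled `ρ` and lies in none of the classes counted later.
  labelling : ∃[ ρ ] Σ[ ℓ ∈ (Fin n → Fin k) ] (∀ {u v} → u ≢ v → c u v ≢ ρ → ℓ u ≡ c u v)
  labelling with ρ , common ← commonColour = ρ , label , label-correct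
    where
    other? : ∀ u → Dec (∃[ v ] v ≢ u × c u v ≢ ρ)
    other? u = Fin.any? λ v → ¬? (v Fin.≟ u) ×-dec ¬? (c u v Fin.≟ ρ)

    label : Fin n → Fin k
    label u with other? u
    ... | yes (v , _) = c u v
    ... | no  _       = ρ

    label-correct : ∀ {u v} → u ≢ v → c u v ≢ ρ → label u ≡ c u v
    label-correct {u} {v} uv p with other? u
    ... | no none = contradiction (v , uv ∘ sym , p) none
    ... | yes (w , wu , q) =
      not-first wu (p ∘ sym) (common u) (v , uv ∘ sym , refl) q

-- The star in the dominant colour

cyclicPred : ∀ {m} → Fin m → Fin m
cyclicPred {suc m} zero    = fromℕ m
cyclicPred {suc m} (suc i) = inject₁ i

cyclicPred-injective : ∀ {m} {i j : Fin m} → cyclicPred i ≡ cyclicPred j → i ≡ j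
cyclicPred-injective {i = zero}  {zero}  _  = refl
cyclicPred-injective {i = zero}  {suc j} eq = contradiction eq Fin.fromℕ≢inject₁
cyclicPred-injective {i = suc i} {zero}  eq = contradiction (sym eq) Fin.fromℕ≢inject₁
cyclicPred-injective {i = suc i} {suc j} eq = cong suc (Fin.inject₁-injective eq)

-- On `Fin 1` the shift is the identity, hence `2 ≤ m`.
cyclicPred-moves : ∀ {m} → 2 ≤ m → (i : Fin m) → cyclicPred i ≢ i
cyclicPred-moves {suc (suc m)} _       zero    ()
cyclicPred-moves {suc zero}    (s≤s ()) zero
cyclicPred-moves               (s≤s _) (suc i) eq =
  ℕ.1+n≢n (trans (cong toℕ (sym eq)) (Fin.toℕ-inject₁ i))

-- The numbering is that of the added edges in `StarEdge`, lowered by one because the centre takes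
-- the number 0.
lookup-pairs : ∀ {A : Set} {R : A → A → Set} {m} {f g : Fin m → A} → (∀ s → R (f s) (g s)) → ∀ zs →
  let xs = concat (List.tabulate λ s → f s ∷ g s ∷ []) ++ zs in
  ∀ (i j : Fin (length xs)) s → s < m → toℕ i ≡ 2 * s → toℕ j ≡ 1 + 2 * s →
  R (lookup xs i) (lookup xs j)
lookup-pairs {m = suc m} fRg zs zero       (suc zero)    zero    _         _ _ = fRg zero
lookup-pairs {m = suc m} fRg zs zero       j             (suc s) _         () _
lookup-pairs {m = suc m} fRg zs (suc zero) j             (suc s) _         p _ =
  contradiction (trans p (ℕ.*-suc 2 s)) λ ()
lookup-pairs {m = suc m} fRg zs (suc (suc i)) zero          (suc s) _  p ()
lookup-pairs {m = suc m} fRg zs (suc (suc i)) (suc zero)    (suc s) _  p q =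
  contradiction (trans q (cong suc (ℕ.*-suc 2 s))) λ ()
lookup-pairs {R = R} {m = suc m} fRg zs (suc (suc i)) (suc (suc j)) (suc s) (s≤s s<m) p q =
  lookup-pairs {R = R} (λ s → fRg (suc s)) zs i j s s<m
    (ℕ.suc-injective (ℕ.suc-injective (trans p (ℕ.*-suc 2 s))))
    (ℕ.suc-injective (ℕ.suc-injective (trans q (cong suc (ℕ.*-suc 2 s)))))

module DominantColour {m n} (c : Fin n → Fin n → Fin (suc (suc m))) (c-sym : ∀ u v → c u v ≡ c v u)
                      (exact : ∀ κ → ∃[ u ] ∃[ v ] u ≢ v × c u v ≡ κ)
                      {ρ} {ℓ : Fin n → Fin (suc (suc m))}
                      (ℓ-correct : ∀ {u v} → u ≢ v → c u v ≢ ρ → ℓ u ≡ c u v) where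

  across : ∀ {u v} → ℓ u ≢ ℓ v → c u v ≡ ρ
  across {u} {v} ne = decidable-stable (c u v Fin.≟ ρ) λ p →
    let uv = λ { refl → ne refl } in
    ne (trans (ℓ-correct uv p)
      (trans (c-sym u v) (sym (ℓ-correct (uv ∘ sym) (p ∘ trans (c-sym u v))))))

  twoLabelled : ∀ {κ} → κ ≢ ρ → ∃[ x ] ∃[ y ] x ≢ y × ℓ x ≡ κ × ℓ y ≡ κ
  twoLabelled {κ} κ≢ρ with x , y , xy , refl ← exact κ =
    x , y , xy , ℓ-correct xy κ≢ρ ,
    trans (ℓ-correct (xy ∘ sym) (κ≢ρ ∘ trans (c-sym x y))) (c-sym y x)

  class outside : Fin (suc (suc m)) → List (Fin n)
  class   κ = filter (λ x → ℓ x Fin.≟ κ) (allFin n)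
  outside κ = filter (λ x → ¬? (ℓ x Fin.≟ κ)) (allFin n)

  ∈-outside⁻ : ∀ {κ x} → x ∈ outside κ → ℓ x ≢ κ
  ∈-outside⁻ {κ} = proj₂ ∘ ∈.∈-filter⁻ (λ x → ¬? (ℓ x Fin.≟ κ)) {xs = allFin n}

  class+outside : ∀ κ → length (class κ) + length (outside κ) ≡ n
  class+outside κ = trans (length-filter-¬ (λ x → ℓ x Fin.≟ κ) (allFin n)) (List.length-tabulate _)

  -- Otherwise each of the `suc m` classes has at least `n ∸ T` vertices. They are disjoint, so
  -- `suc m * (n ∸ T) ≤ n`, against `T < m * (n ∸ T)`.
  largeOutside : ∀ {T} → T < m * (n ∸ T) → T ≤ n → ∃[ κ ] κ ≢ ρ × T < length (outside κ)
  largeOutside {T} many T≤n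
    with Fin.any? (λ κ → ¬? (κ Fin.≟ ρ) ×-dec (T ℕ.<? length (outside κ)))
  ... | yes p   = p
  ... | no none = contradiction total (ℕ.<⇒≱ exceeds)
    where
    classes : List (List (Fin n))
    classes = List.tabulate (λ s → class (punchIn ρ s))

    class-≥ : ∀ s → n ∸ T ≤ length (class (punchIn ρ s))
    class-≥ s = ℕ.m≤n+o⇒m∸n≤o n T (subst (_≤ T + length (class (punchIn ρ s)))
      (trans (ℕ.+-comm (length (outside (punchIn ρ s))) _) (class+outside (punchIn ρ s)))
      (ℕ.+-monoˡ-≤ _ (ℕ.≮⇒≥ λ large → none (punchIn ρ s , Fin.punchInᵢ≢i ρ s , large))))

    ∈-class⁻ : ∀ {κ x} → x ∈ class κ → ℓ x ≡ κ
    ∈-class⁻ {κ} = proj₂ ∘ ∈.∈-filter⁻ (λ x → ℓ x Fin.≟ κ) {xs = allFin n}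

    classes! : List.Unique (concat classes)
    classes! = ListUnique.concat⁺
      (All.tabulate⁺ λ s → ListUnique.filter⁺ (λ x → ℓ x Fin.≟ punchIn ρ s) (ListUnique.allFin⁺ n))
      (AllPairs.tabulate⁺ λ s≢s′ (p , q) →
        s≢s′ (Fin.punchIn-injective ρ _ _ (trans (sym (∈-class⁻ p)) (∈-class⁻ q))))

    total : suc m * (n ∸ T) ≤ n
    total = ℕ.≤-trans (subst (λ z → z * (n ∸ T) ≤ length (concat classes))
      (List.length-tabulate (λ s → class (punchIn ρ s)))
      (length-concat-≥ (All.tabulate⁺ {f = λ s → class (punchIn ρ s)} class-≥))) (unique⇒length≤ classes!)

    exceeds : n < suc m * (n ∸ T)
    exceeds = subst (_< suc m * (n ∸ T)) (ℕ.m∸n+n≡m T≤n) (ℕ.+-monoʳ-< (n ∸ T) many)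

  module _ {κ} (κ≢ρ : κ ≢ ρ) where

    ρ≢κ : ρ ≢ κ
    ρ≢κ = κ≢ρ ∘ sym

    other : Fin m → Fin (suc (suc m))
    other s = punchIn ρ (punchIn (punchOut ρ≢κ) s)

    other≢ρ : ∀ s → other s ≢ ρ
    other≢ρ s = Fin.punchInᵢ≢i ρ _

    other≢κ : ∀ s → other s ≢ κ
    other≢κ s eq = Fin.punchInᵢ≢i (punchOut ρ≢κ) s
      (Fin.punchIn-injective ρ _ _ (trans eq (sym (Fin.punchIn-punchOut ρ≢κ))))

    other-injective : ∀ {s s′} → other s ≡ other s′ → s ≡ s′
    other-injective eq = Fin.punchIn-injective _ _ _ (Fin.punchIn-injective ρ _ _ eq)

    X Y : Fin m → Fin n
    X s = proj₁ (twoLabelled (other≢ρ s))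
    Y s = proj₁ (proj₂ (twoLabelled (other≢ρ s)))

    X≢Y : ∀ s → X s ≢ Y s
    X≢Y s = proj₁ (proj₂ (proj₂ (twoLabelled (other≢ρ s))))

    ℓX : ∀ s → ℓ (X s) ≡ other s
    ℓX s = proj₁ (proj₂ (proj₂ (proj₂ (twoLabelled (other≢ρ s)))))

    ℓY : ∀ s → ℓ (Y s) ≡ other s
    ℓY s = proj₂ (proj₂ (proj₂ (proj₂ (twoLabelled (other≢ρ s)))))

    X-injective : ∀ {s s′} → X s ≡ X s′ → s ≡ s′
    X-injective {s} {s′} eq = other-injective (trans (sym (ℓX s)) (trans (cong ℓ eq) (ℓX s′)))

    Y-injective : ∀ {s s′} → Y s ≡ Y s′ → s ≡ s′
    Y-injective {s} {s′} eq = other-injective (trans (sym (ℓY s)) (trans (cong ℓ eq) (ℓY s′)))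

    X≢Y′ : ∀ s s′ → X s ≢ Y s′
    X≢Y′ s s′ eq with refl ← other-injective {s} {s′} (trans (sym (ℓX s)) (trans (cong ℓ eq) (ℓY s′)))
      = X≢Y s eq

    -- The shift makes the two ends lie in different classes, which the edge
    -- needs to have colour ρ.
    pair : Fin m → List (Fin n)
    pair s = X s ∷ Y (cyclicPred s) ∷ []

    matching : List (Fin n)
    matching = concat (List.tabulate pair)

    ∈-pair⁻ : ∀ {x s} → x ∈ pair s → x ≡ X s ⊎ x ≡ Y (cyclicPred s)
    ∈-pair⁻ (here p)         = inj₁ p
    ∈-pair⁻ (there (here p)) = inj₂ p

    pair-disjoint : ∀ {s s′} → s ≢ s′ → ∀ {x} → ¬ (x ∈ pair s × x ∈ pair s′)
    pair-disjoint ne (p , q) with ∈-pair⁻ p | ∈-pair⁻ q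
    ... | inj₁ refl | inj₁ e = ne (X-injective e)
    ... | inj₁ refl | inj₂ e = X≢Y′ _ _ e
    ... | inj₂ refl | inj₁ e = X≢Y′ _ _ (sym e)
    ... | inj₂ refl | inj₂ e = ne (cyclicPred-injective (Y-injective e))

    matching! : List.Unique matching
    matching! = ListUnique.concat⁺
      (All.tabulate⁺ λ s → (X≢Y′ s (cyclicPred s) ∷ []) ∷ [] ∷ [])
      (AllPairs.tabulate⁺ λ ne → pair-disjoint ne)

    matching-label : ∀ {x} → x ∈ matching → ℓ x ≢ κ
    matching-label x∈
      with xs , x∈xs , xs∈ ← ∈.∈-concat⁻′ (List.tabulate pair) x∈
      with s , refl ← ∈.∈-tabulate⁻ xs∈
      with ∈-pair⁻ x∈xs
    ... | inj₁ refl = λ e → other≢κ s (trans (sym (ℓX s)) e)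
    ... | inj₂ refl = λ e → other≢κ (cyclicPred s) (trans (sym (ℓY _)) e)

    unmatched : List (Fin n)
    unmatched = filter (λ x → ¬? (member? Fin._≟_ x matching)) (outside κ)

    -- The matching comes first because the added edges of the star join its leaves 1 and 2, 3 and
    -- 4, and so on.
    leaves : List (Fin n)
    leaves = matching ++ unmatched

    ∈-unmatched⁻ : ∀ {x} → x ∈ unmatched → x ∈ outside κ × x ∉ matching
    ∈-unmatched⁻ = ∈.∈-filter⁻ (λ x → ¬? (member? Fin._≟_ x matching))

    leaves! : List.Unique leaves
    leaves! = ListUnique.++⁺ matching!
      (ListUnique.filter⁺ _ (ListUnique.filter⁺ _ (ListUnique.allFin⁺ n)))
      λ (p , q) → proj₂ (∈-unmatched⁻ q) p

    leaves-label : ∀ {x} → x ∈ leaves → ℓ x ≢ κ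
    leaves-label x∈ with ∈.∈-++⁻ matching x∈
    ... | inj₁ p = matching-label p
    ... | inj₂ p = ∈-outside⁻ (proj₁ (∈-unmatched⁻ p))

    outside⊆leaves : ∀ {x} → x ∈ outside κ → x ∈ leaves
    outside⊆leaves {x} x∈ with member? Fin._≟_ x matching
    ... | yes p = ∈.∈-++⁺ˡ p
    ... | no ¬p = ∈.∈-++⁺ʳ matching (∈.∈-filter⁺ (λ x → ¬? (member? Fin._≟_ x matching)) x∈ ¬p)

    monochromaticStar : ∀ {r t} → 2 ≤ m → r ≤ m → t ≤ suc (length (outside κ)) →
      ∃[ φ ] (∀ {i j} → φ i ≡ φ j → i ≡ j) ×
             (∀ {i j : Fin t} → StarEdge r (toℕ i) (toℕ j) → c (φ i) (φ j) ≡ ρ)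
    monochromaticStar {r} {t} 2≤m r≤m t≤ = φ , φ-injective , φ-edge
      where
      centre = proj₁ (twoLabelled κ≢ρ)

      ℓ-centre : ℓ centre ≡ κ
      ℓ-centre = proj₁ (proj₂ (proj₂ (proj₂ (twoLabelled κ≢ρ))))

      vertices! : List.Unique (centre ∷ leaves)
      vertices! = All.tabulate (λ x∈ e → leaves-label x∈ (trans (cong ℓ (sym e)) ℓ-centre)) ∷ leaves!

      t≤′ : t ≤ suc (length leaves)
      t≤′ = ℕ.≤-trans t≤ (s≤s (unique-⊆⇒length≤
        (ListUnique.filter⁺ _ (ListUnique.allFin⁺ n)) outside⊆leaves))

      ψ : Fin (suc (length leaves)) → Fin n
      ψ = lookup (centre ∷ leaves)

      φ : Fin t → Fin n
      φ i = ψ (inject≤ i t≤′)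

      φ-injective : ∀ {i j} → φ i ≡ φ j → i ≡ j
      φ-injective eq = Fin.inject≤-injective t≤′ t≤′ _ _ (lookup-injective vertices! _ _ eq)

      matched : ∀ s → c (X s) (Y (cyclicPred s)) ≡ ρ
      matched s = across λ e → cyclicPred-moves 2≤m s
        (sym (other-injective (trans (sym (ℓX s)) (trans e (ℓY _)))))

      ψ-edge : ∀ i j → StarEdge r (toℕ i) (toℕ j) → c (ψ i) (ψ j) ≡ ρ
      ψ-edge zero    (suc j) (inj₁ _) =
        across λ e → leaves-label (∈.∈-lookup {xs = leaves} j) (trans (sym e) ℓ-centre)
      ψ-edge (suc i) (suc j) (inj₂ (s , s<r , p , q)) =
        lookup-pairs {R = λ x y → c x y ≡ ρ} matched unmatched i j s (ℕ.<-≤-trans s<r r≤m) (ℕ.suc-injective p) (ℕ.suc-injective q)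

      φ-edge : ∀ {i j} → StarEdge r (toℕ i) (toℕ j) → c (φ i) (φ j) ≡ ρ
      φ-edge {i} {j} e = ψ-edge (inject≤ i t≤′) (inject≤ j t≤′)
        (subst₂ (StarEdge r) (sym (Fin.toℕ-inject≤ i t≤′)) (sym (Fin.toℕ-inject≤ j t≤′)) e)

-- From vertex tuples to copies in complete graphs

anyVec? : ∀ {n} m {P : Vec (Fin n) m → Set} → (∀ v → Dec (P v)) → Dec (∃[ v ] P v)
anyVec? zero    P? = map′ (λ p → [] , p) (λ { ([] , p) → p }) (P? [])
anyVec? (suc m) P? = map′ (λ (x , v , p) → x ∷ v , p) (λ { (x ∷ v , p) → x , v , p })
  (Fin.any? λ x → anyVec? m λ v → P? (x ∷ v))

-- An exhaustive search makes the choice between rainbow path and monochromatic star constructive.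
rainbowPath? : ∀ {n k} (c : Fin n → Fin n → Fin k) → Dec (∃[ vs ] RainbowPath c vs)
rainbowPath? c = anyVec? 5 λ vs → unique? Fin._≟_ vs ×-dec unique? Fin._≟_ (pathColours c vs)

copyIntoComplete : ∀ {G n} (φ : V G → Fin n) → (∀ {u v} → φ u ≡ φ v → u ≡ v) → Copy G (K n)
copyIntoComplete {G} φ φ-injective = record
  { vertex    = φ
  ; injective = φ-injective
  ; edge      = λ { e eq → Graph.adj-irrefl G (subst (Adj G _) (sym (φ-injective eq)) e) }
  }

pathEdge : ∀ {n u v} → Adj (P (suc n)) u v →
           ∃[ i ] SameEnds u v (inject₁ i) (suc i)
pathEdge {v = suc i} (fwd e) =
  i , inj₁ (Fin.toℕ-injective (trans (ℕ.suc-injective e) (sym (Fin.toℕ-inject₁ i))) , refl)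
pathEdge {u = suc i} (bwd e) =
  i , inj₂ (refl , Fin.toℕ-injective (trans (ℕ.suc-injective e) (sym (Fin.toℕ-inject₁ i))))

lookup-pathColours : ∀ {A B : Set} (c : A → A → B) vs (i : Fin 4) →
  Vec.lookup (pathColours c vs) i ≡ c (Vec.lookup vs (inject₁ i)) (Vec.lookup vs (suc i))
lookup-pathColours c (_ ∷ _ ∷ _ ∷ _ ∷ _ ∷ []) 0F = refl
lookup-pathColours c (_ ∷ _ ∷ _ ∷ _ ∷ _ ∷ []) 1F = refl
lookup-pathColours c (_ ∷ _ ∷ _ ∷ _ ∷ _ ∷ []) 2F = refl
lookup-pathColours c (_ ∷ _ ∷ _ ∷ _ ∷ _ ∷ []) 3F = refl

module Total {n k} (κ₀ : Fin k) (c : ExactColouring k (K n)) where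

  -- κ₀ is a junk value on the diagonal.
  total : Fin n → Fin n → Fin k
  total u v with u Fin.≟ v
  ... | yes _   = κ₀
  ... | no  u≢v = colour c u≢v

  total-colour : ∀ {u v} (e : u ≢ v) → total u v ≡ colour c e
  total-colour {u} {v} e with u Fin.≟ v
  ... | yes u≡v = contradiction u≡v e
  -- Two proofs of `u ≢ v` are compared through the reversed edge, since `well-defined` relates
  -- opposite orientations.
  ... | no  u≢v = trans (ExactColouring.well-defined c u≢v (e ∘ sym))
                        (sym (ExactColouring.well-defined c e (e ∘ sym)))

  total-sym : ∀ u v → total u v ≡ total v u
  total-sym u v with u Fin.≟ v
  ... | yes refl = sym (total-diagonal u)
    where
    total-diagonal : ∀ u → total u u ≡ κ₀
    total-diagonal u with u Fin.≟ u
    ... | yes _ = refl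
    ... | no ne = contradiction refl ne
  ... | no u≢v = trans (ExactColouring.well-defined c u≢v (u≢v ∘ sym)) (sym (total-colour (u≢v ∘ sym)))

  total-exact : ∀ κ → ∃[ u ] ∃[ v ] u ≢ v × total u v ≡ κ
  total-exact κ =
    let u , v , e , p = ExactColouring.exact c κ in u , v , e , trans (total-colour e) p

  rainbowCopy : ∀ {vs} → RainbowPath total vs → Σ[ f ∈ Copy (P 5) (K n) ] Rainbow c f
  rainbowCopy {vs} (vs! , cs!) = f , rainbow
    where
    f = copyIntoComplete (Vec.lookup vs) (Unique.lookup-injective vs! _ _)

    edgeColour : ∀ {u v} (e : Adj (P 5) u v) →
      colour c (edge f e) ≡ Vec.lookup (pathColours total vs) (proj₁ (pathEdge e))
    edgeColour {u} {v} e = trans (sym (total-colour (edge f e))) (ends (proj₂ (pathEdge e)))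
      where
      ends : ∀ {i} → SameEnds u v (inject₁ i) (suc i) →
             total (Vec.lookup vs u) (Vec.lookup vs v) ≡ Vec.lookup (pathColours total vs) i
      ends {i} (inj₁ (refl , refl)) = sym (lookup-pathColours total vs i)
      ends {i} (inj₂ (refl , refl)) = trans (total-sym (Vec.lookup vs u) (Vec.lookup vs v)) (sym (lookup-pathColours total vs i))

    sameEnds : ∀ {A : Set} {u v x y z w : A} → SameEnds u v z w → SameEnds x y z w → SameEnds u v x y
    sameEnds (inj₁ (refl , refl)) (inj₁ (refl , refl)) = inj₁ (refl , refl)
    sameEnds (inj₁ (refl , refl)) (inj₂ (refl , refl)) = inj₂ (refl , refl)
    sameEnds (inj₂ (refl , refl)) (inj₁ (refl , refl)) = inj₂ (refl , refl)
    sameEnds (inj₂ (refl , refl)) (inj₂ (refl , refl)) = inj₁ (refl , refl)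

    rainbow : Rainbow c f
    rainbow {u} {v} e e′ eq = sameEnds (proj₂ (pathEdge e))
      (subst (λ i → SameEnds _ _ (inject₁ i) (suc i))
        (sym (Unique.lookup-injective cs! _ _
          (trans (sym (edgeColour e)) (trans eq (edgeColour e′)))))
        (proj₂ (pathEdge e′)))

  starCopy : ∀ {r t ρ} (φ : Fin t → Fin n) → (∀ {i j} → φ i ≡ φ j → i ≡ j) →
    (∀ {i j} → StarEdge r (toℕ i) (toℕ j) → total (φ i) (φ j) ≡ ρ) →
    Σ[ f ∈ Copy (S t r) (K n) ] Monochromatic c f
  starCopy {r} {t} {ρ} φ φ-injective φ-edge = f , ρ , mono
    where
    f = copyIntoComplete {G = S t r} φ φ-injective

    mono : ∀ {u v} (e : Adj (S t r) u v) → colour c (edge f e) ≡ ρ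
    mono e@(fwd s) = trans (sym (total-colour (edge f e))) (φ-edge s)
    mono {u} {v} e@(bwd s) =
      trans (sym (total-colour (edge f e))) (trans (total-sym (φ u) (φ v)) (φ-edge s))

-- The upper bound

¬rich⇒twoColours : ∀ {n k} {c : Fin n → Fin n → Fin k} {a} →
  ¬ (∀ κ₁ κ₂ → ∃[ x ] x ≢ a × c a x ≢ κ₁ × c a x ≢ κ₂) →
  ∃[ κ₁ ] ∃[ κ₂ ] ∀ x → x ≢ a → c a x ≡ κ₁ ⊎ c a x ≡ κ₂
¬rich⇒twoColours {k = k} {c} {a} ¬rich =
  let κ₁ , p = Fin.¬∀⟶∃¬ k _ (λ κ₁ → Fin.all? (third? κ₁)) ¬rich
      κ₂ , q = Fin.¬∀⟶∃¬ k _ (third? κ₁) p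
  in κ₁ , κ₂ , λ x xa → decidable-stable ((c a x Fin.≟ κ₁) ⊎-dec (c a x Fin.≟ κ₂))
       λ new → q (x , xa , new ∘ inj₁ , new ∘ inj₂)
  where
  third? : ∀ κ₁ κ₂ → Dec (∃[ x ] x ≢ a × c a x ≢ κ₁ × c a x ≢ κ₂)
  third? κ₁ κ₂ = Fin.any? λ x →
    ¬? (x Fin.≟ a) ×-dec ¬? (c a x Fin.≟ κ₁) ×-dec ¬? (c a x Fin.≟ κ₂)

-- Here k = 2 + m and t = 2 + T.
unavoidable : ∀ {m n r T p q} → 3 ≤ m → r ≤ m → suc m ≤ T → T ≡ p * m + q → q < m →
  suc (T + p) ≤ n → 3 + T ≤ n → (c : ExactColouring (2 + m) (K n)) →
  (Σ[ f ∈ Copy (P 5) (K n) ] Rainbow c f) ⊎ (Σ[ f ∈ Copy (S (2 + T) r) (K n) ] Monochromatic c f)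
unavoidable {m} {suc n} {r} {T} {p} {q} 3≤m r≤m m<T T≡ q<m n≥ n≥′ c =
  case rainbowPath? total of λ where
    (yes (_ , path)) → inj₁ (rainbowCopy path)
    (no noPath)      → inj₂ (monochromaticCopy λ vs path → noPath (vs , path))
  where
  open Total {suc n} {2 + m} zero c

  5≤k : 5 ≤ 2 + m
  5≤k = s≤s (s≤s 3≤m)
  5≤n : 5 ≤ suc n
  5≤n = ℕ.≤-trans (s≤s (s≤s (s≤s (ℕ.≤-trans (ℕ.≤-trans (s≤s (s≤s z≤n)) (ℕ.≤-trans 3≤m (ℕ.n≤1+n m))) m<T)))) n≥′

  -- The order is at least t + p - 1, so `suc n ∸ T` is at least `suc p`.
  many : T < m * (suc n ∸ T)
  many = begin-strict
    T                 ≡⟨ T≡ ⟩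
    p * m + q         <⟨ ℕ.+-monoʳ-< (p * m) q<m ⟩
    p * m + m         ≡⟨ ℕ.+-comm (p * m) m ⟩
    suc p * m         ≡⟨ ℕ.*-comm (suc p) m ⟩
    m * suc p         ≤⟨ ℕ.*-monoʳ-≤ m (ℕ.m+n≤o⇒m≤o∸n (suc p) (subst (_≤ suc n) (cong suc (ℕ.+-comm T p)) n≥)) ⟩
    m * (suc n ∸ T)   ∎
    where open ℕ.≤-Reasoning

  monochromaticCopy : (∀ vs → ¬ RainbowPath total vs) →
                      Σ[ f ∈ Copy (S (2 + T) r) (K (suc n)) ] Monochromatic c f
  monochromaticCopy noRainbow = case Fin.any? AtVertex.rich₃? of λ where
      (yes (a , rich)) →
        let γ , mono = AtVertex.rich⇒monochromaticOff a rich total-exact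
            -- Here `n` is the order without `a`, so t + 1 vertices in total are required.
            t≤n = s≤s⁻¹ n≥′
            φ = λ i → punchIn a (inject≤ i t≤n)
            φ-injective = λ {i} {j} eq → Fin.inject≤-injective t≤n t≤n i j (Fin.punchIn-injective a _ _ eq)
        in starCopy φ φ-injective
             (λ {i} {j} e → mono _ _ (Fin.punchInᵢ≢i a _) (Fin.punchInᵢ≢i a _)
               λ eq → starEdge-irrefl (subst (λ z → StarEdge r (toℕ z) (toℕ j)) (φ-injective eq) e))
      (no noRich) →
        let ρ , ℓ , ℓ-correct = Dominance.labelling 5≤k total total-sym total-exact
              (λ a → ¬rich⇒twoColours {c = total} (λ rich → noRich (a , rich)))
            open DominantColour total total-sym total-exact ℓ-correct
            κ , κ≢ρ , large = largeOutside many (ℕ.≤-trans (ℕ.m≤n+m T 3) n≥′)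
            φ , φ-injective , φ-edge =
              monochromaticStar κ≢ρ (ℕ.≤-trans (s≤s (s≤s z≤n)) 3≤m) r≤m (s≤s large)
        in starCopy φ φ-injective φ-edge
    where
    open Structure 5≤n 5≤k total total-sym noRainbow

-- Extremal colourings

fromTotal : ∀ {n k} (d : Fin n → Fin n → Fin k) → (∀ u v → d u v ≡ d v u) →
            (∀ κ → ∃[ u ] ∃[ v ] u ≢ v × d u v ≡ κ) → ExactColouring k (K n)
fromTotal d d-sym d-exact = record
  { colour       = λ {u} {v} _ → d u v
  ; well-defined = λ {u} {v} _ _ → d-sym u v
  ; exact        = d-exact
  }

-- `Forces` speaks of all orders from `M` on, so one bad colouring of `K n` excludes every `M ≤ n`.
avoids⇒< : ∀ {k n M G H} (c : ExactColouring k (K n)) →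
  (∀ f → ¬ Rainbow {G = G} c f) → (∀ f → ¬ Monochromatic {G = H} c f) → Forces k G H M → n < M
avoids⇒< c noRainbow noMono (_ , force) = ℕ.≰⇒> λ M≤n → case force _ M≤n c of λ where
  (inj₁ (f , p)) → noRainbow f p
  (inj₂ (f , p)) → noMono f p

rainbow⇒distinct : ∀ {n k m} {c : ExactColouring k (K n)} {f : Copy (P (suc m)) (K n)} → Rainbow c f →
  ∀ {i j : Fin m} (e : Adj (P (suc m)) (inject₁ i) (suc i)) (e′ : Adj (P (suc m)) (inject₁ j) (suc j)) →
  i ≢ j → colour c (edge f e) ≢ colour c (edge f e′)
rainbow⇒distinct rainbow {i} {j} e e′ i≢j eq with rainbow e e′ eq
... | inj₁ (_ , p) = i≢j (Fin.suc-injective p)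
... | inj₂ (p , q) = ℕ.m≢1+n+m (toℕ i) {1}
  (trans (sym (Fin.toℕ-inject₁ i)) (trans (cong toℕ p)
    (cong suc (trans (sym (Fin.toℕ-inject₁ j)) (sym (cong toℕ q))))))

module StarColouring (k′ T : ℕ) (k′≤T : k′ ≤ T) where

  -- The first edges at the special vertex get different colours and all later ones repeat the last,
  -- so that k - 1 colours are used up.
  cap : Fin (3 + T) → Fin (2 + k′)
  cap j = fromℕ< {toℕ j ⊓ suc k′} (s≤s (ℕ.m⊓n≤n (toℕ j) (suc k′)))

  d : Fin (4 + T) → Fin (4 + T) → Fin (3 + k′)
  d zero    zero    = zero
  d zero    (suc j) = suc (cap j)
  d (suc i) zero    = suc (cap i)
  d (suc i) (suc j) = zero

  d-sym : ∀ u v → d u v ≡ d v u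
  d-sym zero    zero    = refl
  d-sym zero    (suc j) = refl
  d-sym (suc i) zero    = refl
  d-sym (suc i) (suc j) = refl

  k≤t : 2 + k′ ≤ 3 + T
  k≤t = ℕ.≤-trans (s≤s (s≤s k′≤T)) (ℕ.n≤1+n _)

  cap-inject : ∀ κ → cap (inject≤ κ k≤t) ≡ κ
  cap-inject κ = Fin.toℕ-injective (trans (Fin.toℕ-fromℕ< _)
    (trans (cong (_⊓ suc k′) (Fin.toℕ-inject≤ κ k≤t)) (ℕ.m≤n⇒m⊓n≡m (s≤s⁻¹ (Fin.toℕ<n κ)))))

  d-exact : ∀ κ → ∃[ u ] ∃[ v ] u ≢ v × d u v ≡ κ
  d-exact zero    = 1F , 2F , (λ ()) , refl
  d-exact (suc κ) = 0F , suc (inject≤ κ k≤t) , (λ ()) , cong suc (cap-inject κ)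

  colouring : ExactColouring (3 + k′) (K (4 + T))
  colouring = fromTotal d d-sym d-exact

  d-off : ∀ {u v} → u ≢ zero → v ≢ zero → d u v ≡ zero
  d-off {zero}          u≢0 _   = contradiction refl u≢0
  d-off {suc _} {zero}  _   v≢0 = contradiction refl v≢0
  d-off {suc _} {suc _} _   _   = refl

  d-at : ∀ {u v} → u ≢ v → u ≡ zero → d u v ≢ zero
  d-at {v = zero}  u≢v refl _ = u≢v refl
  d-at {v = suc _} u≢v refl ()

  -- A vertex lies on at most two of the four edges of the path, so two edges avoid the special
  -- vertex and share the colour 0.
  noRainbow : ∀ f → ¬ Rainbow {G = P 5} colouring f
  noRainbow f rainbow = cases
    where
    g = vertex f

    different : ∀ {i j} → i ≢ j → g j ≡ zero → g i ≢ zero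
    different i≢j p q = i≢j (Copy.injective f (trans q (sym p)))

    distinct : ∀ {i j : Fin 4} (e : Adj (P 5) (inject₁ i) (suc i)) (e′ : Adj (P 5) (inject₁ j) (suc j)) →
               i ≢ j → d (g (inject₁ i)) (g (suc i)) ≢ d (g (inject₁ j)) (g (suc j))
    distinct = rainbow⇒distinct {c = colouring} {f} rainbow

    cases : ⊥
    cases with g 1F Fin.≟ zero | g 2F Fin.≟ zero | g 3F Fin.≟ zero
    ... | yes p | _ | _ = distinct {2F} {3F} (fwd refl) (fwd refl) (λ ())
      (trans (d-off (different (λ ()) p) (different (λ ()) p))
        (sym (d-off (different (λ ()) p) (different (λ ()) p))))
    ... | _ | yes p | _ = distinct {0F} {3F} (fwd refl) (fwd refl) (λ ())
      (trans (d-off (different (λ ()) p) (different (λ ()) p))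
        (sym (d-off (different (λ ()) p) (different (λ ()) p))))
    ... | _ | _ | yes p = distinct {0F} {1F} (fwd refl) (fwd refl) (λ ())
      (trans (d-off (different (λ ()) p) (different (λ ()) p))
        (sym (d-off (different (λ ()) p) (different (λ ()) p))))
    ... | no p | no q | no r = distinct {1F} {2F} (fwd refl) (fwd refl) (λ ())
      (trans (d-off p q) (sym (d-off q r)))

  -- A copy uses all vertices, hence the special one, whose edges are not coloured 0. Some edge of
  -- the star avoids it: another spoke, or, if it is the centre, the added edge provided by `1 ≤ r`.
  noMonochromatic : ∀ {r} → 1 ≤ r → ∀ f → ¬ Monochromatic {G = S (4 + T) r} colouring f
  noMonochromatic {r} 1≤r f (κ , mono) = covered (Fin.any? λ w → g w Fin.≟ zero)
    where
    g = vertex f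

    spoke : ∀ j → Adj (S (4 + T) r) zero (suc j)
    spoke j = fwd (inj₁ (refl , z<s))

    clash : ∀ {w v x y} → g w ≡ zero → w ≢ v → w ≢ x → w ≢ y →
            d (g w) (g v) ≡ κ → d (g x) (g y) ≡ κ → ⊥
    clash p wv wx wy q q′ = d-at (wv ∘ Copy.injective f) p
      (trans q (trans (sym q′) (d-off (λ e → wx (Copy.injective f (trans p (sym e))))
                                      (λ e → wy (Copy.injective f (trans p (sym e)))))))

    covered : Dec (∃[ w ] g w ≡ zero) → ⊥
    covered (yes (zero , p)) =
      clash {v = 1F} {1F} {2F} p (λ ()) (λ ()) (λ ()) (mono (spoke 0F))
        (mono {1F} {2F} (fwd (inj₂ (0 , 1≤r , refl , refl))))
    covered (yes (1F , p)) =
      clash {v = 0F} {0F} {2F} p (λ ()) (λ ()) (λ ())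
        (trans (d-sym (g 1F) (g 0F)) (mono (spoke 0F))) (mono (spoke 1F))
    covered (yes (suc (suc w) , p)) =
      clash {v = 0F} {0F} {1F} p (λ ()) (λ ()) (λ ())
        (trans (d-sym (g (suc (suc w))) (g 0F)) (mono (spoke (suc w)))) (mono (spoke 0F))
    covered (no none) = ℕ.1+n≰n (Fin.injective⇒≤ {f = λ w → punchOut (avoid w)}
      λ {w} {w′} eq → Copy.injective f (Fin.punchOut-injective (avoid w) (avoid w′) eq))
      where
      avoid : ∀ w → zero ≢ g w
      avoid w e = none (w , sym e)

module ResidueColouring (m′ p n : ℕ) (2≤p : 2 ≤ p) (pm≤n : p * suc (suc m′) ≤ n) where

  m : ℕ
  m = suc (suc m′)

  ℓ : Fin n → Fin m
  ℓ v = toℕ v mod m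

  -- The vertex `i * m + κ`; thus each residue class has at least `p` vertices.
  member : Fin m → Fin p → Fin n
  member κ i = inject≤ (combine i κ) pm≤n

  member-injective : ∀ {κ i j} → member κ i ≡ member κ j → i ≡ j
  member-injective {κ} {i} {j} eq =
    Fin.combine-injectiveˡ i κ j κ (Fin.inject≤-injective pm≤n pm≤n _ _ eq)

  ℓ-member : ∀ κ i → ℓ (member κ i) ≡ κ
  ℓ-member κ i = Fin.toℕ-injective (begin
    toℕ (toℕ (member κ i) mod m)   ≡⟨ Fin.toℕ-fromℕ< _ ⟩
    toℕ (member κ i) % m           ≡⟨ cong (_% m) (trans (Fin.toℕ-inject≤ _ pm≤n) (Fin.toℕ-combine i κ)) ⟩
    (m * toℕ i + toℕ κ) % m        ≡⟨ cong (_% m) (trans (ℕ.+-comm (m * toℕ i) _) (cong (toℕ κ +_) (ℕ.*-comm m (toℕ i)))) ⟩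
    (toℕ κ + toℕ i * m) % m        ≡⟨ [m+kn]%n≡m%n (toℕ κ) (toℕ i) m ⟩
    toℕ κ % m                      ≡⟨ m<n⇒m%n≡m (Fin.toℕ<n κ) ⟩
    toℕ κ                          ∎)
    where open ≡-Reasoning

  d : Fin n → Fin n → Fin (suc m)
  d u v with ℓ u Fin.≟ ℓ v
  ... | yes _ = suc (ℓ u)
  ... | no  _ = zero

  d-same : ∀ {u v} → ℓ u ≡ ℓ v → d u v ≡ suc (ℓ u)
  d-same {u} {v} eq with ℓ u Fin.≟ ℓ v
  ... | yes _ = refl
  ... | no ne = contradiction eq ne

  d-different : ∀ {u v} → ℓ u ≢ ℓ v → d u v ≡ zero
  d-different {u} {v} ne with ℓ u Fin.≟ ℓ v
  ... | yes eq = contradiction eq ne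
  ... | no _   = refl

  d-sym : ∀ u v → d u v ≡ d v u
  d-sym u v = by (ℓ u Fin.≟ ℓ v)
    where
    by : Dec (ℓ u ≡ ℓ v) → d u v ≡ d v u
    by (yes eq) = trans (d-same eq) (trans (cong suc eq) (sym (d-same (sym eq))))
    by (no ne)  = trans (d-different ne) (sym (d-different (ne ∘ sym)))

  d-exact : ∀ κ → ∃[ u ] ∃[ v ] u ≢ v × d u v ≡ κ
  d-exact zero =
    let u = member 0F i; v = member 1F i
        ne : ℓ u ≢ ℓ v
        ne eq = case trans (sym (ℓ-member 0F i)) (trans eq (ℓ-member 1F i)) of λ ()
    in u , v , (λ eq → ne (cong ℓ eq)) , d-different ne
    where i = fromℕ< (ℕ.≤-trans (s≤s z≤n) 2≤p)
  -- An edge inside the class takes two members, hence `2 ≤ p`.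
  d-exact (suc κ) =
    member κ i , member κ j ,
    (λ eq → ℕ.0≢1+n (trans (sym (Fin.toℕ-fromℕ< _))
      (trans (cong toℕ (member-injective {κ} eq)) (Fin.toℕ-fromℕ< _)))) ,
    trans (d-same (trans (ℓ-member κ i) (sym (ℓ-member κ j)))) (cong suc (ℓ-member κ i))
    where
    i = fromℕ< (ℕ.≤-trans (s≤s z≤n) 2≤p)
    j = fromℕ< 2≤p

  colouring : ExactColouring (suc m) (K n)
  colouring = fromTotal d d-sym d-exact

  adjacentEdges : ∀ u v w → d u v ≢ d v w → d u v ≡ zero ⊎ d v w ≡ zero
  adjacentEdges u v w ne with ℓ u Fin.≟ ℓ v | ℓ v Fin.≟ ℓ w
  ... | no _     | _     = inj₁ refl
  ... | yes _    | no _  = inj₂ refl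
  ... | yes u~v  | yes _ = contradiction (cong suc u~v) ne

  -- Of two touching edges with different colours one has colour 0. Each half of the path, on either
  -- side of its middle vertex, thus contributes an edge of colour 0.
  noRainbow : ∀ f → ¬ Rainbow {G = P 5} colouring f
  noRainbow f rainbow = clash
    (adjacentEdges (g 0F) (g 1F) (g 2F) (distinct {0F} {1F} (fwd refl) (fwd refl) λ ()))
    (adjacentEdges (g 2F) (g 3F) (g 4F) (distinct {2F} {3F} (fwd refl) (fwd refl) λ ()))
    where
    g = vertex f

    distinct : ∀ {i j : Fin 4} (e : Adj (P 5) (inject₁ i) (suc i)) (e′ : Adj (P 5) (inject₁ j) (suc j)) →
               i ≢ j → d (g (inject₁ i)) (g (suc i)) ≢ d (g (inject₁ j)) (g (suc j))
    distinct = rainbow⇒distinct {c = colouring} {f} rainbow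

    clash : d (g 0F) (g 1F) ≡ zero ⊎ d (g 1F) (g 2F) ≡ zero →
            d (g 2F) (g 3F) ≡ zero ⊎ d (g 3F) (g 4F) ≡ zero → ⊥
    clash (inj₁ p) (inj₁ q) = distinct {0F} {2F} (fwd refl) (fwd refl) (λ ()) (trans p (sym q))
    clash (inj₁ p) (inj₂ q) = distinct {0F} {3F} (fwd refl) (fwd refl) (λ ()) (trans p (sym q))
    clash (inj₂ p) (inj₁ q) = distinct {1F} {2F} (fwd refl) (fwd refl) (λ ()) (trans p (sym q))
    clash (inj₂ p) (inj₂ q) = distinct {1F} {3F} (fwd refl) (fwd refl) (λ ()) (trans p (sym q))

  -- The leaves of a monochromatic star miss a whole class: that of the centre if the colour is 0,
  -- and any class but the centre's otherwise. So `t` leaves and `p` members of that class would fit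
  -- into `n` vertices.
  noMonochromatic : ∀ {r t} → n < t + p → ∀ f → ¬ Monochromatic {G = S (suc t) r} colouring f
  noMonochromatic {r} {t} n<t+p f (κ , mono) = tooMany (missedClass κ spoke)
    where
    g = vertex f

    spoke : ∀ j → d (g zero) (g (suc j)) ≡ κ
    spoke j = mono (fwd (inj₁ (refl , z<s)))

    missedClass : ∀ κ → (∀ j → d (g zero) (g (suc j)) ≡ κ) → ∃[ κ′ ] (∀ j → ℓ (g (suc j)) ≢ κ′)
    missedClass zero    sp = ℓ (g zero) , λ j eq →
      case trans (sym (sp j)) (d-same (sym eq)) of λ ()
    missedClass (suc κ) sp = κ′ , λ j eq → case ℓ (g zero) Fin.≟ ℓ (g (suc j)) of λ where
        (yes s) → κ′≢κ (trans (sym eq) (trans (sym s) (Fin.suc-injective (trans (sym (d-same s)) (sp j)))))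
        (no ne) → case trans (sym (d-different ne)) (sp j) of λ ()
      where
      κ′ = punchIn κ zero
      κ′≢κ = Fin.punchInᵢ≢i κ zero

    tooMany : ∃[ κ′ ] (∀ j → ℓ (g (suc j)) ≢ κ′) → ⊥
    tooMany (κ′ , missed) = ℕ.<⇒≱ n<t+p (subst (_≤ n)
      (trans (List.length-++ leaves) (cong₂ _+_ (List.length-tabulate (λ j → g (suc j)))
                                               (List.length-tabulate (member κ′))))
      (unique⇒length≤ (ListUnique.++⁺
        (ListUnique.tabulate⁺ (λ eq → Fin.suc-injective (Copy.injective f eq)))
        (ListUnique.tabulate⁺ (member-injective {κ′}))
        disjoint)))
      where
      leaves = List.tabulate (λ j → g (suc j))
      members = List.tabulate (member κ′)

      disjoint : ∀ {x} → ¬ (x ∈ leaves × x ∈ members)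
      disjoint (p , q) with j , refl ← ∈.∈-tabulate⁻ p | i , eq ← ∈.∈-tabulate⁻ q =
        missed j (trans (cong ℓ eq) (ℓ-member κ′ i))

-- Combining the bounds

n≤[1+n]C2 : ∀ n → n ≤ suc n ℕ.C 2
n≤[1+n]C2 n = subst (_≤ suc n ℕ.C 2) (ℕ.nC1≡n n)
  (subst (n ℕ.C 1 ≤_) (ℕ.nCk+nC[k+1]≡[n+1]C[k+1] n 1) (ℕ.m≤m+n (n ℕ.C 1) (n ℕ.C 2)))

k≤NC2 : ∀ {k N} → suc k ≤ N → k ≤ N ℕ.C 2
k≤NC2 (s≤s k≤n) = ℕ.≤-trans k≤n (n≤[1+n]C2 _)

theorem3p1 : (k r t p q : ℕ) →
    5 ≤ k → k ≤ t ∸ 1 →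
    1 ≤ r → r ≤ k ∸ 2 →
    2 * r + 2 ≤ t →
    t ∸ 2 ≡ p * (k ∸ 2) + q → q ≤ k ∸ 3 →
    IsGallaiRamsey k (P 5) (S t r) ((t + p ∸ 1) ⊔ (t + 1))
-- Orders t below 4 contradict the bounds on k; removing them lets the truncated subtractions
-- compute.
theorem3p1 (suc _) _ 0 _ _ _ ()
theorem3p1 (suc _) _ 1 _ _ _ ()
theorem3p1 _ _ 2 _ _ (s≤s (s≤s _)) (s≤s ())
theorem3p1 _ _ 3 _ _ (s≤s (s≤s (s≤s _))) (s≤s (s≤s ()))
theorem3p1 k@(suc (suc (suc (suc (suc a))))) r (suc (suc (suc (suc b)))) p q
  5≤k@(s≤s (s≤s (s≤s (s≤s (s≤s _))))) k≤3+b 1≤r r≤m _ T≡ q≤ =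
    (k≤NC2 (ℕ.≤-trans (s≤s (ℕ.≤-trans k≤3+b (ℕ.n≤1+n _))) 5+b≤N) , upper)
  , λ M forces → ℕ.⊔-lub (residueBound forces) (starBound forces)
  where
  N = (3 + b + p) ⊔ (4 + b + 1)

  5+b≡ : 4 + b + 1 ≡ 5 + b
  5+b≡ = ℕ.+-comm (4 + b) 1

  5+b≤N : 5 + b ≤ N
  5+b≤N = subst (_≤ N) 5+b≡ (ℕ.m≤n⊔m (3 + b + p) (4 + b + 1))

  upper : ∀ n → N ≤ n → (c : ExactColouring k (K n)) → _
  upper n N≤n c = unavoidable (s≤s (s≤s (s≤s z≤n))) r≤m (s≤s⁻¹ k≤3+b) T≡ (s≤s q≤)
    (ℕ.m⊔n≤o⇒m≤o (3 + b + p) (4 + b + 1) N≤n) (ℕ.≤-trans 5+b≤N N≤n) c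

  starBound : ∀ {M} → Forces k (P 5) (S (4 + b) r) M → 4 + b + 1 ≤ M
  starBound {M} forces = subst (_≤ M) (sym 5+b≡) (avoids⇒< colouring noRainbow (noMonochromatic 1≤r) forces)
    where open StarColouring (2 + a) b (s≤s⁻¹ (s≤s⁻¹ (s≤s⁻¹ k≤3+b)))

  residueBound : ∀ {M} → Forces k (P 5) (S (4 + b) r) M → 3 + b + p ≤ M
  -- For p at most 2, t + p - 1 does not exceed t + 1 and the star colouring suffices; otherwise the
  -- classes are large enough for the residue colouring to be exact.
  residueBound {M} forces with p ℕ.≤? 2
  ... | yes p≤2 = ℕ.≤-trans
    (subst (3 + b + p ≤_) (trans (ℕ.+-comm (3 + b) 2) refl) (ℕ.+-monoʳ-≤ (3 + b) p≤2))
    (subst (_≤ M) 5+b≡ (starBound forces))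
  ... | no p≰2 = avoids⇒< colouring noRainbow (noMonochromatic ℕ.≤-refl) forces
    where
    pm≤n : p * (4 + a) ≤ 2 + b + p
    pm≤n = begin
      p * (4 + a)           ≡⟨ ℕ.*-suc p (3 + a) ⟩
      p + p * (3 + a)       ≤⟨ ℕ.+-monoʳ-≤ p (ℕ.m≤m+n _ q) ⟩
      p + (p * (3 + a) + q) ≡⟨ cong (p +_) (sym T≡) ⟩
      p + (2 + b)           ≡⟨ ℕ.+-comm p (2 + b) ⟩
      2 + b + p             ∎
      where open ℕ.≤-Reasoning
    open ResidueColouring (2 + a) p (2 + b + p) (ℕ.≤-trans (ℕ.n≤1+n 2) (ℕ.≰⇒> p≰2)) pm≤n
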